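{- Let $n\ge 0$, let $X\subseteq\{0,1\}^n$ be nonempty, and let $G=Q_n(X)$ be the daisy cube generated by $X$. Then $$D_{G,0^n}(x,y)=W_{G,0^n}(x+y)\quad\text{and}\quad C_G(x)=W_{G,0^n}(x+1).$$
   Context: The $n$-cube $Q_n$ is the graph with vertex set $\{0,1\}^n$, two words being adjacent if they differ in exactly one coordinate ($Q_0=K_1$). $0^n$ is the all-zero word. For $u,v\in\{0,1\}^n$ write $u\le v$ if $u_i\le v_i$ for all $i$. For $X\subseteq\{0,1\}^n$, the daisy cube $Q_n(X)$ generated by $X$ is the subgraph of $Q_n$ induced by $\{u\in\{0,1\}^n : u\le x \text{ for some } x\in X\}$. For a finite graph $G$, $c_k(G)$ ($k\ge0$) is the number of induced subgraphs of $G$ isomorphic to $Q_k$, and the cube polynomial is $C_G(x)=\sum_{k\ge 0}c_k(G)x^k$. For $u\in V(G)$ and a subgraph $H$ of $G$, $d(u,H)=\min_{v\in V(H)}d_G(u,v)$. Let $c_{k,d}(G)$ ($k,d\ge 0$) be the number of induced subgraphs $H$ of $G$ isomorphic to $Q_k$ with $d(u,H)=d$. The distance cube polynomial of $G$ with respect to $u$ is $D_{G,u}(x,y)=\sum_{k,d\ge0}c_{k,d}(G)x^ky^d$. Let $w_d(G)$ be the number of vertices of $G$ at distance $d$ from $u$ in $G$, and set $W_{G,u}(x)=\sum_{d\ge0}w_d(G)x^d$. -}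

module Defs where

open import Algebra.Bundles.Raw using (RawSemiring)
import Algebra.Definitions.RawMonoid as RawMonoidDefs
open import Data.Bool.Base as Bool using (Bool; true; false)
import Data.Bool.Properties as Bool
import Data.Fin.Properties as Fin
open import Data.Fin.Subset.Properties using (anySubset?)
open import Data.Irrelevant using ([_])
open import Data.List.Base as List
  using (List; []; _∷_; _++_; map; length; filter; applyUpTo; cartesianProductWith)
open import Data.List.Membership.Propositional using (_∈_; lose; find)
open import Data.List.Membership.Propositional.Properties
  using (∈-cartesianProductWith⁺)
import Data.List.Membership.DecPropositional as DecMembership
open import Data.List.Relation.Unary.All as All using (All; []; _∷_)
open import Data.List.Relation.Unary.AllPairs using ([]; _∷_)
open import Data.List.Relation.Unary.Any as Any using (Any; here; there; index)
open import Data.List.Relation.Unary.Any.Properties using (lookup-index)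
open import Data.List.Relation.Unary.Unique.Propositional using (Unique)
open import Data.List.Relation.Unary.Unique.Propositional.Properties
  using (cartesianProductWith⁺)
open import Data.Nat.Base as ℕ using (ℕ; zero; suc; _≤_; _<_; +-*-rawSemiring)
import Data.Nat.Properties as ℕ
open import Data.Product using (∃; ∃!; _×_; _,_; proj₁; proj₂)
open import Data.Refinement as Refinement
  using (Refinement-syntax; value; value-injective; _,_)
open import Data.Vec.Base as Vec using (Vec; []; _∷_; lookup; replicate)
import Data.Vec.Properties as Vec
open import Data.Vec.Relation.Binary.Pointwise.Inductive as Pointwise
  using (Pointwise; []; _∷_)
open import Function.Base using (_∘_)
open import Function.Bundles using (_↔_; _⇔_; mk↔ₛ′; mk⇔; Inverse; Equivalence)
open import Level using (Level; 0ℓ)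
open import Relation.Binary.Core using (Rel)
import Relation.Binary.Definitions as Binary
open import Relation.Binary.PropositionalEquality
  using (_≡_; _≢_; _≗_; refl; sym; trans; cong; subst₂)
open import Relation.Nullary
  using (¬_; Dec; yes; no; map′; ¬?; _×-dec_; _→-dec_; contradiction-irr)
open import Relation.Unary using (Pred; Decidable; Satisfiable)

private
  variable
    A B : Set
    n : ℕ

count : {P : Pred A 0ℓ} → Decidable P → List A → ℕ
count P? xs = length (filter P? xs)

Least : Pred ℕ 0ℓ → Pred ℕ 0ℓ
Least P m = P m × (∀ {l} → P l → m ≤ l)

least? : {P : Pred ℕ 0ℓ} → Decidable P → Decidable (Least P)
least? {P = P} P? m =
  map′ least below (P? m ×-dec ℕ.allUpTo? (λ l → ¬? (P? l)) m)
  where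
  NoneBelow : Set
  NoneBelow = P m × (∀ {l} → l < m → ¬ P l)

  least : NoneBelow → Least P m
  least (pm , free) = pm , λ pl → ℕ.≮⇒≥ λ l<m → free l<m pl

  below : Least P m → NoneBelow
  below (pm , min) = pm , λ l<m pl → ℕ.<⇒≱ l<m (min pl)

-- For a duplicate-free xs, each subset of its elements is listed exactly once.
sublists : List A → List (List A)
sublists []       = [] ∷ []
sublists (x ∷ xs) = map (x ∷_) (sublists xs) ++ sublists xs

vecs : List A → ∀ n → List (Vec A n)
vecs xs zero    = [] ∷ []
vecs xs (suc n) = cartesianProductWith _∷_ xs (vecs xs n)

∈-vecs : {xs : List A} → (∀ x → x ∈ xs) → (v : Vec A n) → v ∈ vecs xs n
∈-vecs all∈ []      = here refl
∈-vecs all∈ (x ∷ v) = ∈-cartesianProductWith⁺ _∷_ (all∈ x) (∈-vecs all∈ v)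

vecs-unique : {xs : List A} → Unique xs → ∀ n → Unique (vecs xs n)
vecs-unique xs! zero    = [] ∷ []
vecs-unique xs! (suc n) =
  cartesianProductWith⁺ _∷_ Vec.∷-injective xs! (vecs-unique xs! n)

module _ {P : Pred A 0ℓ} (P? : Decidable P) where

  refine : List A → List [ x ∈ A ∣ P x ]
  refine []       = []
  refine (x ∷ xs) with P? x
  ... | yes px = (x , [ px ]) ∷ refine xs
  ... | no  _  = refine xs

  ∈-refine⁺ : ∀ {xs} (r : [ x ∈ A ∣ P x ]) → value r ∈ xs → r ∈ refine xs
  ∈-refine⁺ {x ∷ xs} (_ , [ p ]) (here refl) with P? x
  ... | yes _  = here refl
  ... | no  ¬p = contradiction-irr p ¬p
  ∈-refine⁺ {x ∷ xs} r (there r∈) with P? x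
  ... | yes _ = there (∈-refine⁺ r r∈)
  ... | no  _ = ∈-refine⁺ r r∈

  refine-All : {Q : Pred A 0ℓ} → ∀ {xs} → All Q xs → All (Q ∘ value) (refine xs)
  refine-All []                 = []
  refine-All (_∷_ {x} qx qxs) with P? x
  ... | yes _ = qx ∷ refine-All qxs
  ... | no  _ = refine-All qxs

  refine-unique : ∀ {xs} → Unique xs → Unique (refine xs)
  refine-unique []                  = []
  refine-unique (_∷_ {x} x∉xs xs!) with P? x
  ... | yes _ = All.map (λ x≢y → x≢y ∘ cong value) (refine-All x∉xs) ∷ refine-unique xs!
  ... | no  _ = refine-unique xs!

module _ {xs : List A} (all∈ : ∀ x → x ∈ xs) where

  ∀-finite? : {P : Pred A 0ℓ} → Decidable P → Dec (∀ x → P x)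
  ∀-finite? P? = map′ (λ ps x → All.lookup ps (all∈ x)) (λ f → All.universal f xs)
                      (All.all? P? xs)

  ∃-finite? : {P : Pred A 0ℓ} → Decidable P → Dec (∃ P)
  ∃-finite? P? = map′ (λ p → let x , _ , px = find p in x , px)
                      (λ (x , px) → lose (all∈ x) px)
                      (Any.any? P? xs)

  -- Functions on A are tabulated as vectors indexed by the positions in xs.
  ∃-function? : {ys : List B} → (∀ y → y ∈ ys) → {Q : Pred (A → B) 0ℓ} →
                (∀ {f g} → f ≗ g → Q f → Q g) → Decidable Q → Dec (∃ Q)
  ∃-function? {B = B} {ys} all∈′ {Q} resp Q? = map′
    (λ p → let t , _ , qt = find p in fun t , qt)
    (λ (f , qf) → lose (∈-vecs all∈′ (table f)) (resp (λ x → sym (fun-table f x)) qf))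
    (Any.any? (Q? ∘ fun) (vecs ys (length xs)))
    where
    fun : Vec B (length xs) → A → B
    fun t x = lookup t (index (all∈ x))

    table : (A → B) → Vec B (length xs)
    table f = Vec.tabulate (f ∘ List.lookup xs)

    fun-table : ∀ f → fun (table f) ≗ f
    fun-table f x = trans (Vec.lookup∘tabulate _ (index (all∈ x)))
                          (cong f (sym (lookup-index (all∈ x))))

record Graph : Set₁ where
  infix 4 _≟_ _~_ _~?_
  field
    V        : Set
    _≟_      : Binary.DecidableEquality V
    vertices : List V
    complete : ∀ v → v ∈ vertices
    unique   : Unique vertices
    _~_      : Rel V 0ℓ
    _~?_     : Binary.Decidable _~_
    ~-sym    : Binary.Symmetric _~_
    ~-irrefl : ∀ {v} → ¬ (v ~ v)

  order : ℕ
  order = length vertices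

open Graph using (V; vertices; order)

infix 4 _≅_
record _≅_ (G H : Graph) : Set where
  private
    module G = Graph G
    module H = Graph H
  field
    bijection : V G ↔ V H
  open Inverse bijection public using (to)
  field
    adjacency : ∀ u v → u G.~ v ⇔ to u H.~ to v

_≅?_ : ∀ G H → Dec (G ≅ H)
G ≅? H = map′
  (λ (f , g , fg , gf , adj) → record
     { bijection = mk↔ₛ′ f g fg gf
     ; adjacency = λ u v → mk⇔ (proj₁ (adj u v)) (proj₂ (adj u v)) })
  maps
  (∃-function? G.complete H.complete resp-to λ f →
   ∃-function? H.complete G.complete (resp-from f) λ g →
     ∀-finite? H.complete (λ y → f (g y) H.≟ y) ×-dec
     ∀-finite? G.complete (λ x → g (f x) G.≟ x) ×-dec
     ∀-finite? G.complete λ u → ∀-finite? G.complete λ v →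
       ((u G.~? v) →-dec (f u H.~? f v)) ×-dec ((f u H.~? f v) →-dec (u G.~? v)))
  where
  module G = Graph G
  module H = Graph H

  IsIso : (V G → V H) → (V H → V G) → Set
  IsIso f g = (∀ y → f (g y) ≡ y) × (∀ x → g (f x) ≡ x) ×
              (∀ u v → (u G.~ v → f u H.~ f v) × (f u H.~ f v → u G.~ v))

  maps : G ≅ H → ∃ λ f → ∃ (IsIso f)
  maps iso = to , from , strictlyInverseˡ , strictlyInverseʳ ,
             λ u v → Equivalence.to (adjacency u v) , Equivalence.from (adjacency u v)
    where
    open _≅_ iso using (bijection; adjacency)
    open Inverse bijection

  resp-from : ∀ f {g g′} → g ≗ g′ → IsIso f g → IsIso f g′
  resp-from f e (fg , gf , adj) =
    (λ y → trans (cong f (sym (e y))) (fg y)) ,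
    (λ x → trans (sym (e (f x))) (gf x)) ,
    adj

  resp-to : ∀ {f f′} → f ≗ f′ → ∃ (IsIso f) → ∃ (IsIso f′)
  resp-to e (g , fg , gf , adj) = g ,
    (λ y → trans (sym (e (g y))) (fg y)) ,
    (λ x → trans (cong g (sym (e x))) (gf x)) ,
    λ u v → subst₂ H._~_ (e u) (e v) ∘ proj₁ (adj u v) ,
            proj₂ (adj u v) ∘ subst₂ H._~_ (sym (e u)) (sym (e v))

induced : (G : Graph) {P : Pred (V G) 0ℓ} → Decidable P → Graph
induced G {P} P? = record
  { V        = [ v ∈ V G ∣ P v ]
  ; _≟_      = Refinement._≟_ G._≟_
  ; vertices = refine P? G.vertices
  ; complete = λ v → ∈-refine⁺ P? v (G.complete (value v))
  ; unique   = refine-unique P? G.unique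
  ; _~_      = λ u v → value u G.~ value v
  ; _~?_     = λ u v → value u G.~? value v
  ; ~-sym    = G.~-sym
  ; ~-irrefl = G.~-irrefl
  }
  where module G = Graph G

module _ (G : Graph) where
  open Graph G using (_≟_; _~_; _~?_; complete)
  open DecMembership _≟_ using (_∈?_)

  inducedOn : List (V G) → Graph
  inducedOn S = induced G (_∈? S)

  data Walk : V G → V G → ℕ → Set where
    []  : ∀ {u} → Walk u u 0
    _∷_ : ∀ {u v w l} → u ~ v → Walk v w l → Walk u w (suc l)

  walk? : ∀ u v → Decidable (Walk u v)
  walk? u v zero    = map′ (λ { refl → [] }) (λ { [] → refl }) (u ≟ v)
  walk? u v (suc l) = map′ (λ (_ , e , p) → e ∷ p) (λ { (e ∷ p) → _ , e , p })
                           (∃-finite? complete λ w → (u ~? w) ×-dec walk? w v l)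

  -- Dist u v d means d(u,v) = d; no d qualifies if u and v are not connected.
  Dist : V G → V G → ℕ → Set
  Dist u v = Least (Walk u v)

  dist? : ∀ u v → Decidable (Dist u v)
  dist? u v = least? (walk? u v)

  DistTo : V G → List (V G) → ℕ → Set
  DistTo u S = Least (λ d → Any (λ v → Dist u v d) S)

  distTo? : ∀ u S → Decidable (DistTo u S)
  distTo? u S = least? (λ d → Any.any? (λ v → dist? u v d) S)

Word : ℕ → Set
Word n = Vec Bool n

bits : List Bool
bits = false ∷ true ∷ []

∈-bits : ∀ b → b ∈ bits
∈-bits false = here refl
∈-bits true  = there (here refl)

bits-unique : Unique bits
bits-unique = ((λ ()) ∷ []) ∷ [] ∷ []

Adjacent : Rel (Word n) 0ℓ
Adjacent u v = ∃! _≡_ λ i → lookup u i ≢ lookup v i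

adjacent? : Binary.Decidable (Adjacent {n})
adjacent? u v = Fin.any? λ i → differ? i ×-dec
  map′ (λ f {j} → f j) (λ f j → f {j}) (Fin.all? λ j → differ? j →-dec (i Fin.≟ j))
  where
  differ? : ∀ i → Dec (lookup u i ≢ lookup v i)
  differ? i = ¬? (lookup u i Bool.≟ lookup v i)

Q : ℕ → Graph
Q n = record
  { V        = Word n
  ; _≟_      = Vec.≡-dec Bool._≟_
  ; vertices = vecs bits n
  ; complete = ∈-vecs ∈-bits
  ; unique   = vecs-unique bits-unique n
  ; _~_      = Adjacent
  ; _~?_     = adjacent?
  ; ~-sym    = λ (i , u≢v , only) → i , u≢v ∘ sym , λ v≢u → only (v≢u ∘ sym)
  ; ~-irrefl = λ (i , u≢u , _) → u≢u refl
  }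

infix 4 _≼_ _≼?_
_≼_ : Rel (Word n) 0ℓ
_≼_ = Pointwise Bool._≤_

_≼?_ : Binary.Decidable (_≼_ {n})
_≼?_ = Pointwise.decidable Bool._≤?_

zeroWord : ∀ n → Word n
zeroWord n = replicate n false

zeroWord-min : (v : Word n) → zeroWord n ≼ v
zeroWord-min []      = []
zeroWord-min (b ∷ v) = Bool.≤-minimum b ∷ zeroWord-min v

module _ {X : Pred (Word n) 0ℓ} (X? : Decidable X) where

  Below : Pred (Word n) 0ℓ
  Below u = ∃ λ x → X x × u ≼ x

  below? : Decidable Below
  below? u = anySubset? λ x → X? x ×-dec u ≼? x

  daisyCube : Graph
  daisyCube = induced (Q n) below?

  daisyZero : Satisfiable X → V daisyCube
  daisyZero (x , x∈X) = zeroWord n , [ (x , x∈X , zeroWord-min x) ]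

-- R[t] by coefficient lists, constant coefficient first.  Trailing zeros are
-- allowed, so equality compares the coefficients at every index.
module _ {c ℓ} (R : RawSemiring c ℓ) where
  open RawSemiring R
  open RawMonoidDefs +-rawMonoid using () renaming (_×_ to _·_)

  coeff : List Carrier → ℕ → Carrier
  coeff []      _       = 0#
  coeff (a ∷ p) zero    = a
  coeff (a ∷ p) (suc i) = coeff p i

  addPoly : List Carrier → List Carrier → List Carrier
  addPoly []      q       = q
  addPoly (a ∷ p) []      = a ∷ p
  addPoly (a ∷ p) (b ∷ q) = (a + b) ∷ addPoly p q

  mulPoly : List Carrier → List Carrier → List Carrier
  mulPoly []      q = []
  mulPoly (a ∷ p) q = addPoly (map (a *_) q) (0# ∷ mulPoly p q)

  polynomials : RawSemiring c ℓ
  polynomials = record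
    { Carrier = List Carrier
    ; _≈_     = λ p q → ∀ i → coeff p i ≈ coeff q i
    ; _+_     = addPoly
    ; _*_     = mulPoly
    ; 0#      = []
    ; 1#      = 1# ∷ []
    }

  -- Horner evaluation; a · 1# is the image of the natural number a in R.
  evaluate : List ℕ → Carrier → Carrier
  evaluate []      r = 0#
  evaluate (a ∷ p) r = (a · 1#) + (r * evaluate p r)

ℕ[x] : RawSemiring 0ℓ 0ℓ
ℕ[x] = polynomials +-*-rawSemiring

-- ℕ[x][y]: the outer index is the exponent of y, the inner one that of x.
ℕ[x,y] : RawSemiring 0ℓ 0ℓ
ℕ[x,y] = polynomials ℕ[x]

module ℕ[x] where
  open RawSemiring ℕ[x] public

  x : Carrier
  x = 0 ∷ 1 ∷ []

module ℕ[x,y] where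
  open RawSemiring ℕ[x,y] public

  x y : Carrier
  x = ℕ[x].x ∷ []
  y = ℕ[x].0# ∷ ℕ[x].1# ∷ []

module _ (G : Graph) where

  -- Induced subgraphs are counted through their vertex sets.
  cubes : ℕ → ℕ
  cubes k = count (λ S → inducedOn G S ≅? Q k) (sublists (vertices G))

  cubesAt : V G → ℕ → ℕ → ℕ
  cubesAt u k d =
    count (λ S → (inducedOn G S ≅? Q k) ×-dec distTo? G u S d) (sublists (vertices G))

  verticesAt : V G → ℕ → ℕ
  verticesAt u d = count (λ v → dist? G u v d) (vertices G)

  -- Indices below the order of G suffice: a k-cube has 2 ^ k > k vertices, and a
  -- shortest walk repeats no vertex, so all further coefficients are zero.
  cubePolynomial : List ℕ
  cubePolynomial = applyUpTo cubes (order G)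

  distanceCubePolynomial : V G → List (List ℕ)
  distanceCubePolynomial u =
    applyUpTo (λ d → applyUpTo (λ k → cubesAt u k d) (order G)) (order G)

  distancePolynomial : V G → List ℕ
  distancePolynomial u = applyUpTo (verticesAt u) (order G)

{-# OPTIONS --safe #-}

-- An injective homomorphism Q_k → Q_n has a face {u : a ≼ u ≼ b} as its image: split Q_k into
-- two halves joined by a perfect matching; the 4-cycles force all matching edges to change the
-- same coordinate i, so the image is a (k-1)-face together with its translate along i.
-- Hence the induced k-cubes of a daisy cube are the faces [a,b] with b in the daisy cube, which
-- is downward closed, and d(0ⁿ,[a,b]) is the weight of a.  A vertex of weight m is the top of
-- (m choose k) such faces, all with bottom of weight m - k, so that
-- c_{k,d} = w_{k+d} (k+d choose k) and c_k = Σ_m w_m (m choose k).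
-- Pascal's rule identifies these with the coefficients of the Horner evaluations.

module Submission where

open import Defs
open import Algebra.Bundles.Raw using (RawSemiring)
import Algebra.Definitions.RawMonoid as RawMonoidDefs
open import Data.Bool.Base as Bool using (false; true; not; b≤b; f≤t)
import Data.Bool.Properties as Bool
open import Data.Fin.Base using (Fin; zero; suc; toℕ)
import Data.Fin.Properties as Fin
open import Data.Irrelevant using ([_])
open import Data.List.Base as List
  using (List; []; _∷_; _++_; map; length; filter; concatMap; applyUpTo)
import Data.List.Membership.DecPropositional as DecMembership
open import Data.List.Membership.Propositional using (_∈_; find; lose)
open import Data.List.Membership.Propositional.Properties
  using (∈-map⁺; ∈-map⁻; ∈-++⁺ˡ; ∈-++⁺ʳ; ∈-++⁻; ∈-filter⁺; ∈-filter⁻;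
         ∈-concatMap⁺; ∈-concatMap⁻)
open import Data.List.Membership.Propositional.Properties.WithK using (unique∧set⇒bag)
open import Data.List.Properties
  using (length-map; length-++; map-cong; filter-≐; filter-accept; filter-reject; filter-none)
open import Data.List.Relation.Binary.BagAndSetEquality using (∼bag⇒↭)
open import Data.List.Relation.Binary.Permutation.Propositional.Properties using (↭-length)
open import Data.List.Relation.Unary.All as All using (All; []; _∷_)
import Data.List.Relation.Unary.All.Properties as All
open import Data.List.Relation.Unary.AllPairs as AllPairs using ([]; _∷_)
import Data.List.Relation.Unary.AllPairs.Properties as AllPairs
open import Data.List.Relation.Unary.Any using (Any; here; there; index)
open import Data.List.Relation.Unary.Any.Properties using (lookup-index)
open import Data.List.Relation.Unary.Unique.Propositional using (Unique)
import Data.List.Relation.Unary.Unique.Propositional.Properties as Unique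
open import Data.Nat.Base
  using (ℕ; zero; suc; _+_; _*_; _≤_; _<_; z≤n; s≤s; +-*-rawSemiring)
open import Data.Nat.Combinatorics
  using (_C_; nCn≡1; nCk≡nC[n∸k]; nCk+nC[k+1]≡[n+1]C[k+1]; k>n⇒nCk≡0)
open import Data.Nat.ListAction using (sum)
open import Data.Nat.Properties as ℕ hiding (_≟_)
open import Algebra.Properties.CommutativeSemigroup +-commutativeSemigroup using (interchange)
open import Data.Product using (∃; ∃₂; _×_; _,_; proj₁; proj₂)
open import Data.Refinement using (value; value-injective; _,_)
open import Data.Sum.Base as Sum using (_⊎_; inj₁; inj₂)
open import Data.Vec.Base using ([]; _∷_; lookup; updateAt)
open import Data.Vec.Properties
  using (∷-injectiveʳ; lookup∘updateAt; lookup∘updateAt′; updateAt-updateAt; updateAt-id-local)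
open import Data.Vec.Relation.Binary.Pointwise.Inductive as Pointwise using ([]; _∷_)
open import Function.Base using (_∘_; case_of_)
open import Function.Bundles using (_⇔_; mk⇔; mk↔ₛ′; Equivalence; Inverse)
open import Level using (0ℓ)
open import Relation.Binary.PropositionalEquality
open import Relation.Nullary using (yes; no; contradiction; recompute; _×-dec_)
open import Relation.Unary using (Pred; Decidable; Satisfiable)

open Equivalence using (to; from)

private
  variable
    A B : Set
    n k : ℕ
    a b u v w : Word n

-- Faces of the hypercube

≼-refl : (v : Word n) → v ≼ v
≼-refl v = Pointwise.refl Bool.≤-refl

≼-trans : u ≼ v → v ≼ w → u ≼ w
≼-trans = Pointwise.trans Bool.≤-trans

≼-antisym : u ≼ v → v ≼ u → u ≡ v
≼-antisym []      []      = refl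
≼-antisym (p ∷ ps) (q ∷ qs) = cong₂ _∷_ (Bool.≤-antisym p q) (≼-antisym ps qs)

flip : Fin n → Word n → Word n
flip i u = updateAt u i not

flip-involutive : (i : Fin n) (u : Word n) → flip i (flip i u) ≡ u
flip-involutive i u = trans (updateAt-updateAt i u)
                            (updateAt-id-local i u (Bool.not-involutive (lookup u i)))

-- Weight and Hamming distance

weight : Word n → ℕ
weight []          = 0
weight (false ∷ u) = weight u
weight (true ∷ u)  = suc (weight u)

weight-zeroWord : ∀ n → weight (zeroWord n) ≡ 0
weight-zeroWord zero    = refl
weight-zeroWord (suc n) = weight-zeroWord n

weight-mono : u ≼ v → weight u ≤ weight v
weight-mono []                       = z≤n
weight-mono (f≤t ∷ ps)               = m≤n⇒m≤1+n (weight-mono ps)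
weight-mono (b≤b {false} ∷ ps)       = weight-mono ps
weight-mono (b≤b {true} ∷ ps)        = s≤s (weight-mono ps)

weight-flip : (i : Fin n) (u : Word n) → weight (flip i u) ≤ suc (weight u)
weight-flip zero    (false ∷ u) = ≤-refl
weight-flip zero    (true ∷ u)  = m≤n⇒m≤1+n (m≤n⇒m≤1+n ≤-refl)
weight-flip (suc i) (false ∷ u) = weight-flip i u
weight-flip (suc i) (true ∷ u)  = s≤s (weight-flip i u)

weight≡0 : (u : Word n) → weight u ≡ 0 → u ≡ zeroWord n
weight≡0 []          _ = refl
weight≡0 (false ∷ u) e = cong (false ∷_) (weight≡0 u e)

lower : ∀ {m} (u : Word n) → weight u ≡ suc m →
        ∃ λ i → flip i u ≼ u × weight (flip i u) ≡ m
lower (false ∷ u) e with i , p , q ← lower u e = suc i , b≤b ∷ p , q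
lower (true ∷ u)  e = zero , f≤t ∷ ≼-refl u , suc-injective e

-- `Adjacent` asks for a unique coordinate; `hamming u v ≡ 1` expresses the same recursively and
-- therefore passes through `embed` by plain induction.
hamming : Word n → Word n → ℕ
hamming []          []          = 0
hamming (false ∷ u) (false ∷ v) = hamming u v
hamming (true ∷ u)  (true ∷ v)  = hamming u v
hamming (false ∷ u) (true ∷ v)  = suc (hamming u v)
hamming (true ∷ u)  (false ∷ v) = suc (hamming u v)

hamming-self : (u : Word n) → hamming u u ≡ 0
hamming-self []          = refl
hamming-self (false ∷ u) = hamming-self u
hamming-self (true ∷ u)  = hamming-self u

hamming≡0 : (u v : Word n) → hamming u v ≡ 0 → u ≡ v
hamming≡0 []          []          _ = refl
hamming≡0 (false ∷ u) (false ∷ v) e = cong (false ∷_) (hamming≡0 u v e)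
hamming≡0 (true ∷ u)  (true ∷ v)  e = cong (true ∷_) (hamming≡0 u v e)

hamming-flip : (i : Fin n) (u : Word n) → hamming u (flip i u) ≡ 1
hamming-flip zero    (false ∷ u) = cong suc (hamming-self u)
hamming-flip zero    (true ∷ u)  = cong suc (hamming-self u)
hamming-flip (suc i) (false ∷ u) = hamming-flip i u
hamming-flip (suc i) (true ∷ u)  = hamming-flip i u

hamming≡1 : (u v : Word n) → hamming u v ≡ 1 → ∃ λ i → v ≡ flip i u
hamming≡1 []          []          ()
hamming≡1 (false ∷ u) (false ∷ v) e with i , refl ← hamming≡1 u v e = suc i , refl
hamming≡1 (true ∷ u)  (true ∷ v)  e with i , refl ← hamming≡1 u v e = suc i , refl
hamming≡1 (false ∷ u) (true ∷ v)  e =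
  zero , cong (true ∷_) (sym (hamming≡0 u v (suc-injective e)))
hamming≡1 (true ∷ u)  (false ∷ v) e =
  zero , cong (false ∷_) (sym (hamming≡0 u v (suc-injective e)))

flip-adjacent : (i : Fin n) (u : Word n) → Adjacent u (flip i u)
flip-adjacent i u = i , differ , unique
  where
  differ : lookup u i ≢ lookup (flip i u) i
  differ e = Bool.not-¬ (sym (trans e (lookup∘updateAt i u))) refl

  unique : ∀ {j} → lookup u j ≢ lookup (flip i u) j → i ≡ j
  unique {j} ne with i Fin.≟ j
  ... | yes p = p
  ... | no  p = contradiction (sym (lookup∘updateAt′ j i (p ∘ sym) u)) ne

lookup-ext : (∀ i → lookup u i ≡ lookup v i) → u ≡ v
lookup-ext {u = []}    {[]}    _ = refl
lookup-ext {u = _ ∷ _} {_ ∷ _} e = cong₂ _∷_ (e zero) (lookup-ext (e ∘ suc))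

adjacent-flip : (u v : Word n) ((i , _) : Adjacent u v) → v ≡ flip i u
adjacent-flip u v (i , differ , unique) = lookup-ext same
  where
  same : ∀ j → lookup v j ≡ lookup (flip i u) j
  same j with i Fin.≟ j
  ... | yes refl = trans (Bool.¬-not (differ ∘ sym)) (sym (lookup∘updateAt i u))
  ... | no  i≢j  with lookup u j Bool.≟ lookup v j
  ...   | yes e = trans (sym e) (sym (lookup∘updateAt′ j i (i≢j ∘ sym) u))
  ...   | no  d = contradiction (unique d) i≢j

adjacent⇒hamming : (u v : Word n) → Adjacent u v → hamming u v ≡ 1
adjacent⇒hamming u v u~v =
  trans (cong (hamming u) (adjacent-flip u v u~v)) (hamming-flip (proj₁ u~v) u)

hamming⇒adjacent : (u v : Word n) → hamming u v ≡ 1 → Adjacent u v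
hamming⇒adjacent u v e with i , refl ← hamming≡1 u v e = flip-adjacent i u

-- Faces as intervals, and images of cubes

Between : Word n → Word n → Word n → Set
Between a b u = a ≼ u × u ≼ b

between? : (a b : Word n) → Decidable (Between a b)
between? a b u = a ≼? u ×-dec u ≼? b

-- A derivation records which coordinates are fixed and which are free. `Face k a b` is inhabited
-- exactly when `a ≼ b` and the two words differ in `k` coordinates, so a face is determined by its
-- least word `a` and its greatest word `b`.
data Face : ℕ → Word n → Word n → Set where
  []    : Face 0 [] []
  fixed : ∀ c → Face k a b → Face k (c ∷ a) (c ∷ b)
  free  : Face k a b → Face (suc k) (false ∷ a) (true ∷ b)

face-≼ : Face k a b → a ≼ b
face-≼ []          = []
face-≼ (fixed _ F) = b≤b ∷ face-≼ F
face-≼ (free F)    = f≤t ∷ face-≼ F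

face-weight : Face k a b → weight b ≡ k + weight a
face-weight []                       = refl
face-weight (fixed false F)          = face-weight F
face-weight {k = k} (fixed true F)   = trans (cong suc (face-weight F)) (sym (+-suc k _))
face-weight (free F)                 = cong suc (face-weight F)

vertex : (u : Word n) → Face 0 u u
vertex []      = []
vertex (c ∷ u) = fixed c (vertex u)

embed : {a b : Word n} → Face k a b → Word k → Word n
embed []          w       = []
embed (fixed c F) w       = c ∷ embed F w
embed (free F)    (x ∷ w) = x ∷ embed F w

project : {a b : Word n} → Face k a b → Word n → Word k
project []          u       = []
project (fixed c F) (_ ∷ u) = project F u
project (free F)    (x ∷ u) = x ∷ project F u

embed-between : (F : Face k a b) (w : Word k) → Between a b (embed F w)
embed-between []          w = [] , []
embed-between (fixed c F) w with p , q ← embed-between F w = b≤b ∷ p , b≤b ∷ q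
embed-between (free F)    (x ∷ w) with p , q ← embed-between F w =
  Bool.≤-minimum x ∷ p , Bool.≤-maximum x ∷ q

project-embed : (F : Face k a b) (w : Word k) → project F (embed F w) ≡ w
project-embed []          []      = refl
project-embed (fixed c F) w       = project-embed F w
project-embed (free F)    (x ∷ w) = cong (x ∷_) (project-embed F w)

embed-project : (F : Face k a b) → Between a b u → embed F (project F u) ≡ u
embed-project {u = []}    []          _                 = refl
-- At a fixed coordinate the letter of `u` is squeezed between `c` and `c`.
embed-project {u = _ ∷ _} (fixed c F) (p ∷ ps , q ∷ qs) =
  cong₂ _∷_ (Bool.≤-antisym p q) (embed-project F (ps , qs))
embed-project {u = _ ∷ _} (free F)    (_ ∷ ps , _ ∷ qs) =
  cong (_ ∷_) (embed-project F (ps , qs))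

hamming-embed : (F : Face k a b) (v w : Word k) → hamming (embed F v) (embed F w) ≡ hamming v w
hamming-embed []              []          []          = refl
hamming-embed (fixed false F) v           w           = hamming-embed F v w
hamming-embed (fixed true F)  v           w           = hamming-embed F v w
hamming-embed (free F)        (false ∷ v) (false ∷ w) = hamming-embed F v w
hamming-embed (free F)        (true ∷ v)  (true ∷ w)  = hamming-embed F v w
hamming-embed (free F)        (false ∷ v) (true ∷ w)  = cong suc (hamming-embed F v w)
hamming-embed (free F)        (true ∷ v)  (false ∷ w) = cong suc (hamming-embed F v w)

-- The union of `[a,b]` and its translate along `i`, presented as a face of one dimension more:
-- `keep` and `move` place both halves inside it, `split` says that there is nothing else.
record Widening (k : ℕ) (a b : Word n) (i : Fin n) : Set where
  field
    {bottom top} : Word n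
    face         : Face (suc k) bottom top
    keep         : Between a b u → Between bottom top u
    move         : Between a b u → Between bottom top (flip i u)
    split        : Between bottom top u → Between a b u ⊎ Between a b (flip i u)

between-∷ : ∀ {c d x} → c Bool.≤ x → x Bool.≤ d → Between a b u → Between (c ∷ a) (d ∷ b) (x ∷ u)
between-∷ p₀ q₀ (p , q) = p₀ ∷ p , q₀ ∷ q

-- A flip at `suc i` leaves the leading letter alone, so all three properties carry over. The face
-- is passed as an argument because the leading coordinate may be fixed or free.
widening-∷ : ∀ {j c d} {i : Fin n} (W : Widening k a b i) →
             Face (suc j) (c ∷ Widening.bottom W) (d ∷ Widening.top W) → Widening j (c ∷ a) (d ∷ b) (suc i)
widening-∷ W F = record
  { face  = F
  ; keep  = λ { {_ ∷ _} (p₀ ∷ p , q₀ ∷ q) → between-∷ p₀ q₀ (keep (p , q)) }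
  ; move  = λ { {_ ∷ _} (p₀ ∷ p , q₀ ∷ q) → between-∷ p₀ q₀ (move (p , q)) }
  ; split = λ { {_ ∷ _} (p₀ ∷ p , q₀ ∷ q) →
                Sum.map (between-∷ p₀ q₀) (between-∷ p₀ q₀) (split (p , q)) }
  }
  where open Widening W

-- If `i` is a free coordinate, the face is closed under flipping it; if `i` is fixed, freeing it
-- gives the widening.
widen : (F : Face k a b) (i : Fin n) →
        (∀ {u} → Between a b u → Between a b (flip i u)) ⊎ Widening k a b i
widen (fixed c F) zero = inj₂ record
  { face  = free F
  ; keep  = λ { {x ∷ _} (_ ∷ p , _ ∷ q) → full x (p , q) }
  ; move  = λ { {x ∷ _} (_ ∷ p , _ ∷ q) → full (not x) (p , q) }
  ; split = λ { {x ∷ _} (_ ∷ p , _ ∷ q) → halve c x (p , q) }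
  }
  where
  full : ∀ x → Between a b u → Between (false ∷ a) (true ∷ b) (x ∷ u)
  full x = between-∷ (Bool.≤-minimum x) (Bool.≤-maximum x)

  -- A word with leading letter `c` lies in the old face; any other is brought there by flipping
  -- that letter.
  halve : ∀ c x → Between a b u →
          Between (c ∷ a) (c ∷ b) (x ∷ u) ⊎ Between (c ∷ a) (c ∷ b) (not x ∷ u)
  halve false false = inj₁ ∘ between-∷ b≤b b≤b
  halve false true  = inj₂ ∘ between-∷ b≤b b≤b
  halve true  false = inj₂ ∘ between-∷ b≤b b≤b
  halve true  true  = inj₁ ∘ between-∷ b≤b b≤b
widen (free F) zero = inj₁ λ { {x ∷ _} (_ ∷ p , _ ∷ q) →
  between-∷ (Bool.≤-minimum (not x)) (Bool.≤-maximum (not x)) (p , q) }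
widen (fixed c F) (suc i) = Sum.map
  (λ stay → λ { {_ ∷ _} (p₀ ∷ p , q₀ ∷ q) → between-∷ p₀ q₀ (stay (p , q)) })
  (λ W → widening-∷ W (fixed c (Widening.face W)))
  (widen F i)
widen (free F) (suc i) = Sum.map
  (λ stay → λ { {_ ∷ _} (p₀ ∷ p , q₀ ∷ q) → between-∷ p₀ q₀ (stay (p , q)) })
  (λ W → widening-∷ W (free (Widening.face W)))
  (widen F i)

-- This is the connectedness of the cube: the tail is changed first, by induction, and then the
-- leading letter, if necessary, by one flip.
constant-along-flips : {C : Set} (g : Word k → C) →
                       (∀ i v → g (flip i v) ≡ g v) → ∀ v w → g v ≡ g w
constant-along-flips {zero}  g step []      []      = refl
constant-along-flips {suc k} g step (x ∷ v) (y ∷ w) =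
  trans (constant-along-flips (g ∘ (x ∷_)) (λ i v → step (suc i) (x ∷ v)) v w) (first x y)
  where
  first : ∀ x y → g (x ∷ w) ≡ g (y ∷ w)
  first false false = refl
  first true  true  = refl
  first false true  = sym (step zero (false ∷ w))
  first true  false = step zero (false ∷ w)

flip-distinct : {i j : Fin n} (u : Word n) → i ≢ j → lookup (flip j u) i ≡ lookup u i
flip-distinct u i≢j = lookup∘updateAt′ _ _ i≢j u

-- In a 4-cycle u, flip i u, flip j u, and their other common neighbour,
-- opposite edges change the same coordinate.
four-cycle : {i j i′ j′ : Fin n} (u : Word n) → i ≢ j → flip i′ (flip j u) ≢ u →
             flip i′ (flip j u) ≡ flip j′ (flip i u) → i′ ≡ i
four-cycle {i = i} {j} {i′} {j′} u i≢j ≢u e with i′ Fin.≟ i | j′ Fin.≟ i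
... | yes p    | _        = p
-- With `j′ ≡ i` the second route flips `i` twice and returns to `u`.
... | no  i′≢i | yes refl = contradiction (trans e (flip-involutive i u)) ≢u
-- Otherwise the route through `flip j u` leaves coordinate `i` unchanged, while the route through
-- `flip i u` negates it.
... | no  i′≢i | no j′≢i  = contradiction (begin
    lookup u i                        ≡⟨ flip-distinct u i≢j ⟨
    lookup (flip j u) i               ≡⟨ flip-distinct (flip j u) (i′≢i ∘ sym) ⟨
    lookup (flip i′ (flip j u)) i     ≡⟨ cong (λ w → lookup w i) e ⟩
    lookup (flip j′ (flip i u)) i     ≡⟨ flip-distinct (flip i u) (j′≢i ∘ sym) ⟩
    lookup (flip i u) i               ≡⟨ lookup∘updateAt i u ⟩
    not (lookup u i)                  ∎) (Bool.not-¬ refl)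
  where open ≡-Reasoning

record Image (f : Word k → Word n) : Set where
  field
    {bottom top} : Word n
    face         : Face k bottom top
    into         : ∀ v → Between bottom top (f v)
    onto         : Between bottom top u → ∃ λ v → f v ≡ u

-- The neighbours of `v` are the words `flip i v`, so the last hypothesis says that `f` preserves
-- adjacency. In the induction `f₀` inherits both hypotheses, and its face is widened along the
-- common direction of the edges from `f₀ v` to `f₁ v`.
image-face : (f : Word k → Word n) → (∀ {v w} → f v ≡ f w → v ≡ w) →
             (∀ i v → ∃ λ j → f (flip i v) ≡ flip j (f v)) → Image f
image-face {zero} f inj hom = record
  { face = vertex (f [])
  ; into = λ { [] → ≼-refl _ , ≼-refl _ }
  ; onto = λ (p , q) → [] , ≼-antisym p q
  }
image-face {suc k} {n} f inj hom = extend (widen I.face i₀)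
  where
  f₀ f₁ : Word k → Word n
  f₀ v = f (false ∷ v)
  f₁ v = f (true ∷ v)

  module I = Image (image-face f₀ (∷-injectiveʳ ∘ inj) λ i v → hom (suc i) (false ∷ v))

  direction : Word k → Fin n
  direction v = proj₁ (hom zero (false ∷ v))

  across : ∀ v → f₁ v ≡ flip (direction v) (f₀ v)
  across v = proj₂ (hom zero (false ∷ v))

  parallel : ∀ i v → direction (flip i v) ≡ direction v
  parallel i v with j , e₀ ← hom (suc i) (false ∷ v) | j′ , e₁ ← hom (suc i) (true ∷ v) =
    -- The cycle consists of `f₀ v`, `f₁ v`, `f₀ (flip i v)` and `f₁ (flip i v)`. Each of the two
    -- degenerate cases would identify a value of `f₀` with a value of `f₁`, against injectivity.
    four-cycle {j = j} {j′ = j′} (f₀ v)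
      (λ { refl → case inj (trans (across v) (sym e₀)) of λ () })
      (λ e → case inj (trans far e) of λ ())
      (trans (sym far) (trans e₁ (cong (flip j′) (across v))))
    where
    far : f₁ (flip i v) ≡ flip (direction (flip i v)) (flip j (f₀ v))
    far = trans (across (flip i v)) (cong (flip (direction (flip i v))) e₀)

  -- The base point is arbitrary, since `direction` is constant.
  i₀ : Fin n
  i₀ = direction (zeroWord k)

  across₀ : ∀ v → f₁ v ≡ flip i₀ (f₀ v)
  across₀ v = trans (across v) (cong (λ i → flip i (f₀ v))
                (constant-along-flips direction parallel v (zeroWord k)))

  extend : (∀ {u} → Between I.bottom I.top u → Between I.bottom I.top (flip i₀ u)) ⊎
           Widening k I.bottom I.top i₀ → Image f
  -- If the face of `f₀` were closed under flipping `i₀`, it would contain a value of `f₁`, which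
  -- would then also be a value of `f₀`.
  extend (inj₁ stay) with v , e ← I.onto (stay (I.into (zeroWord k)))
    with () ← inj (trans e (sym (across₀ (zeroWord k))))
  extend (inj₂ W) = record { face = W.face ; into = into ; onto = onto }
    where
    module W = Widening W

    into : ∀ v → Between W.bottom W.top (f v)
    into (false ∷ v) = W.keep (I.into v)
    into (true ∷ v)  = subst (Between W.bottom W.top) (sym (across₀ v)) (W.move (I.into v))

    onto : Between W.bottom W.top u → ∃ λ v → f v ≡ u
    onto {u} p with W.split p
    ... | inj₁ q with v , e ← I.onto q = false ∷ v , e
    ... | inj₂ q with v , e ← I.onto q = true ∷ v ,
          trans (across₀ v) (trans (cong (flip i₀) e) (flip-involutive i₀ u))

-- Lists

module _ {P : Pred A 0ℓ} (P? : Decidable P) where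

  filter∈sublists : ∀ xs → filter P? xs ∈ sublists xs
  filter∈sublists []       = here refl
  filter∈sublists (x ∷ xs) with P? x
  ... | yes _ = ∈-++⁺ˡ (∈-map⁺ (x ∷_) (filter∈sublists xs))
  ... | no  _ = ∈-++⁺ʳ _ (filter∈sublists xs)

sublists-⊆ : ∀ (xs : List A) {S x} → S ∈ sublists xs → x ∈ S → x ∈ xs
sublists-⊆ []       (here refl) ()
sublists-⊆ (y ∷ xs) S∈ x∈ with ∈-++⁻ (map (y ∷_) (sublists xs)) S∈
... | inj₂ S∈′ = there (sublists-⊆ xs S∈′ x∈)
... | inj₁ S∈′ with _ , T∈ , refl ← ∈-map⁻ (y ∷_) S∈′ with x∈
...   | here e   = here e
...   | there x∈′ = there (sublists-⊆ xs T∈ x∈′)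

sublists-unique : {xs : List A} → Unique xs → Unique (sublists xs)
sublists-unique []                            = [] ∷ []
sublists-unique {xs = x ∷ xs} (x∉xs ∷ xs!) =
  Unique.++⁺ (Unique.map⁺ (λ { refl → refl }) (sublists-unique xs!)) (sublists-unique xs!)
    -- A list in both halves would contain `x` and also be a sublist of `xs`, where `x` does not
    -- occur.
    λ (S∈ , S∈′) → case ∈-map⁻ (x ∷_) S∈ of λ
      { (_ , _ , refl) → All.lookup x∉xs (sublists-⊆ xs S∈′ (here refl)) refl }

-- A sublist keeps the order of `xs`, so its members determine it. This turns equality of vertex
-- sets into equality of lists, with the filtered list as the canonical form.
sublist≡filter : {P : Pred A 0ℓ} (P? : Decidable P) {xs S : List A} → Unique xs →
                 S ∈ sublists xs → (∀ {x} → x ∈ xs → x ∈ S ⇔ P x) → S ≡ filter P? xs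
sublist≡filter P? []                         (here refl) _ = refl
sublist≡filter {P = P} P? {x ∷ xs} (x∉xs ∷ xs!) S∈ S⇔P with ∈-++⁻ (map (x ∷_) (sublists xs)) S∈
... | inj₁ S∈′ with T , T∈ , refl ← ∈-map⁻ (x ∷_) S∈′ =
  trans (cong (x ∷_) (sublist≡filter P? xs! T∈ T⇔P))
        (sym (filter-accept P? (to (S⇔P (here refl)) (here refl))))
  where
  T⇔P : ∀ {y} → y ∈ xs → y ∈ T ⇔ P y
  T⇔P y∈ = mk⇔ (to (S⇔P (there y∈)) ∘ there) λ py → case from (S⇔P (there y∈)) py of λ
    { (here refl) → contradiction refl (All.lookup x∉xs y∈)
    ; (there y∈T) → y∈T }
... | inj₂ S∈′ =
  trans (sublist≡filter P? xs! S∈′ (S⇔P ∘ there))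
        (sym (filter-reject P? λ px →
          All.lookup x∉xs (sublists-⊆ xs S∈′ (from (S⇔P (here refl)) px)) refl))

-- Injectivity is asked only between members of `xs`, because `box` determines its bottom only when
-- that lies below the top.
map-unique : (f : A → B) {xs : List A} → Unique xs →
             (∀ {x y} → x ∈ xs → y ∈ xs → f x ≡ f y → x ≡ y) → Unique (map f xs)
map-unique f []           inj = []
map-unique f (x∉xs ∷ xs!) inj =
  All.map⁺ (All.tabulate λ y∈ e → All.lookup x∉xs y∈ (inj (here refl) (there y∈) e)) ∷
  map-unique f xs! (λ x∈ y∈ → inj (there x∈) (there y∈))

concatMap-unique : (f : A → List B) {xs : List A} → Unique xs →
                   (∀ x → Unique (f x)) →
                   (∀ {x y z} → z ∈ f x → z ∈ f y → x ≡ y) → Unique (concatMap f xs)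
concatMap-unique f xs! f! inj =
  Unique.concat⁺ (All.map⁺ (All.universal f! _))
    (AllPairs.map⁺ (AllPairs.map (λ x≢y {_} (z∈ , z∈′) → x≢y (inj z∈ z∈′)) xs!))

length-concatMap : (f : A → List B) (xs : List A) →
                   length (concatMap f xs) ≡ sum (map (length ∘ f) xs)
length-concatMap f []       = refl
length-concatMap f (x ∷ xs) =
  trans (length-++ (f x)) (cong (length (f x) +_) (length-concatMap f xs))

unique-length : {xs ys : List A} → Unique xs → Unique ys →
                (∀ {x} → x ∈ xs ⇔ x ∈ ys) → length xs ≡ length ys
unique-length xs! ys! eq = ↭-length (∼bag⇒↭ (unique∧set⇒bag xs! ys! eq))

sum-constant : (f : A → ℕ) {c : ℕ} {xs : List A} → All (λ x → f x ≡ c) xs →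
               sum (map f xs) ≡ length xs * c
sum-constant f []       = refl
sum-constant f (e ∷ es) = cong₂ _+_ e (sum-constant f es)

-- Counting faces by their top

nC0≡1 : ∀ n → n C 0 ≡ 1
nC0≡1 n = trans (nCk≡nC[n∸k] {0} {n} z≤n) (nCn≡1 n)

-- The bottoms of the `k`-faces with top `b` arise by lowering `k` of the ones of `b`. A leading one
-- is either lowered or kept, which makes the recursion on lengths Pascal's rule.
lowerEnds : Word n → ℕ → List (Word n)
lowerEnds []          zero    = [] ∷ []
lowerEnds []          (suc k) = []
lowerEnds (false ∷ b) k       = map (false ∷_) (lowerEnds b k)
lowerEnds (true ∷ b)  zero    = map (true ∷_) (lowerEnds b zero)
lowerEnds (true ∷ b)  (suc k) =
  map (false ∷_) (lowerEnds b k) ++ map (true ∷_) (lowerEnds b (suc k))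

lowerEnds⁺ : Face k a b → a ∈ lowerEnds b k
lowerEnds⁺ []                        = here refl
lowerEnds⁺ (fixed false F)           = ∈-map⁺ _ (lowerEnds⁺ F)
lowerEnds⁺ {zero}  (fixed true F)    = ∈-map⁺ _ (lowerEnds⁺ F)
lowerEnds⁺ {suc k} (fixed true F)    = ∈-++⁺ʳ _ (∈-map⁺ _ (lowerEnds⁺ F))
lowerEnds⁺ (free F)                  = ∈-++⁺ˡ (∈-map⁺ _ (lowerEnds⁺ F))

lowerEnds⁻ : ∀ (b : Word n) k → a ∈ lowerEnds b k → Face k a b
lowerEnds⁻ []          zero    (here refl) = []
lowerEnds⁻ (false ∷ b) k       a∈ with _ , a∈′ , refl ← ∈-map⁻ _ a∈ = fixed false (lowerEnds⁻ b k a∈′)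
lowerEnds⁻ (true ∷ b)  zero    a∈ with _ , a∈′ , refl ← ∈-map⁻ _ a∈ = fixed true (lowerEnds⁻ b zero a∈′)
lowerEnds⁻ (true ∷ b)  (suc k) a∈ with ∈-++⁻ (map (false ∷_) (lowerEnds b k)) a∈
... | inj₁ a∈ˡ with _ , a∈′ , refl ← ∈-map⁻ _ a∈ˡ = free (lowerEnds⁻ b k a∈′)
... | inj₂ a∈ʳ with _ , a∈′ , refl ← ∈-map⁻ _ a∈ʳ = fixed true (lowerEnds⁻ b (suc k) a∈′)

lowerEnds-unique : ∀ (b : Word n) k → Unique (lowerEnds b k)
lowerEnds-unique []          zero    = [] ∷ []
lowerEnds-unique []          (suc k) = []
lowerEnds-unique (false ∷ b) k       = Unique.map⁺ ∷-injectiveʳ (lowerEnds-unique b k)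
lowerEnds-unique (true ∷ b)  zero    = Unique.map⁺ ∷-injectiveʳ (lowerEnds-unique b zero)
lowerEnds-unique (true ∷ b)  (suc k) =
  Unique.++⁺ (Unique.map⁺ ∷-injectiveʳ (lowerEnds-unique b k))
             (Unique.map⁺ ∷-injectiveʳ (lowerEnds-unique b (suc k)))
             λ (a∈ , a∈′) → case ∈-map⁻ _ a∈ of λ
               { (_ , _ , refl) → case ∈-map⁻ _ a∈′ of λ () }

length-lowerEnds : ∀ (b : Word n) k → length (lowerEnds b k) ≡ weight b C k
length-lowerEnds []          zero    = refl
length-lowerEnds []          (suc k) = refl
length-lowerEnds (false ∷ b) k       = trans (length-map _ (lowerEnds b k)) (length-lowerEnds b k)
length-lowerEnds (true ∷ b)  zero    = begin
  length (map (true ∷_) (lowerEnds b 0)) ≡⟨ length-map _ (lowerEnds b 0) ⟩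
  length (lowerEnds b 0)                 ≡⟨ length-lowerEnds b 0 ⟩
  weight b C 0                           ≡⟨ nC0≡1 (weight b) ⟩
  1                                      ≡⟨ nC0≡1 (suc (weight b)) ⟨
  suc (weight b) C 0                     ∎
  where open ≡-Reasoning
length-lowerEnds (true ∷ b)  (suc k) = begin
  length (map (false ∷_) (lowerEnds b k) ++ map (true ∷_) (lowerEnds b (suc k)))
    ≡⟨ length-++ (map (false ∷_) (lowerEnds b k)) ⟩
  length (map (false ∷_) (lowerEnds b k)) + length (map (true ∷_) (lowerEnds b (suc k)))
    ≡⟨ cong₂ _+_ (length-map _ (lowerEnds b k)) (length-map _ (lowerEnds b (suc k))) ⟩
  length (lowerEnds b k) + length (lowerEnds b (suc k))
    ≡⟨ cong₂ _+_ (length-lowerEnds b k) (length-lowerEnds b (suc k)) ⟩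
  weight b C k + weight b C suc k
    ≡⟨ nCk+nC[k+1]≡[n+1]C[k+1] (weight b) k ⟩
  suc (weight b) C suc k ∎
  where open ≡-Reasoning

-- Polynomials

applyUpTo-cong : {f g : ℕ → A} → (∀ i → f i ≡ g i) → ∀ n → applyUpTo f n ≡ applyUpTo g n
applyUpTo-cong e zero    = refl
applyUpTo-cong e (suc n) = cong₂ _∷_ (e 0) (applyUpTo-cong (e ∘ suc) n)

module _ {c ℓ} (R : RawSemiring c ℓ) where
  open RawSemiring R using (Carrier; 0#)

  coeff-applyUpTo-< : ∀ (f : ℕ → Carrier) {n i} → i < n → coeff R (applyUpTo f n) i ≡ f i
  coeff-applyUpTo-< f {suc n} {zero}  _         = refl
  coeff-applyUpTo-< f {suc n} {suc i} (s≤s i<n) = coeff-applyUpTo-< (f ∘ suc) i<n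

  coeff-applyUpTo-≥ : ∀ (f : ℕ → Carrier) {n i} → n ≤ i → coeff R (applyUpTo f n) i ≡ 0#
  coeff-applyUpTo-≥ f {zero}          _         = refl
  coeff-applyUpTo-≥ f {suc n} {suc i} (s≤s n≤i) = coeff-applyUpTo-≥ (f ∘ suc) n≤i

  coeff-applyUpTo : ∀ (f : ℕ → Carrier) {n} → (∀ {i} → n ≤ i → f i ≡ 0#) →
                    ∀ i → coeff R (applyUpTo f n) i ≡ f i
  coeff-applyUpTo f {n} vanish i with <-≤-connex i n
  ... | inj₁ i<n = coeff-applyUpTo-< f i<n
  ... | inj₂ n≤i = trans (coeff-applyUpTo-≥ f n≤i) (sym (vanish n≤i))

-- weightedSum (w₀ ∷ w₁ ∷ …) g is the value of w₀ + w₁ t + … under the linear map tᵐ ↦ g m.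
weightedSum : List ℕ → (ℕ → ℕ) → ℕ
weightedSum []      g = 0
weightedSum (w ∷ W) g = w * g 0 + weightedSum W (g ∘ suc)

weightedSum-cong : ∀ W {g h} → (∀ m → g m ≡ h m) → weightedSum W g ≡ weightedSum W h
weightedSum-cong []      e = refl
weightedSum-cong (w ∷ W) e = cong₂ _+_ (cong (w *_) (e 0)) (weightedSum-cong W (e ∘ suc))

weightedSum-+ : ∀ W g h → weightedSum W (λ m → g m + h m) ≡ weightedSum W g + weightedSum W h
weightedSum-+ []      g h = refl
weightedSum-+ (w ∷ W) g h = trans
  (cong₂ _+_ (*-distribˡ-+ w (g 0) (h 0)) (weightedSum-+ W (g ∘ suc) (h ∘ suc)))
  (interchange (w * g 0) (w * h 0) _ _)

weightedSum-applyUpTo-+ : ∀ (f f′ : ℕ → ℕ) n g →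
  weightedSum (applyUpTo (λ m → f m + f′ m) n) g ≡
  weightedSum (applyUpTo f n) g + weightedSum (applyUpTo f′ n) g
weightedSum-applyUpTo-+ f f′ zero    g = refl
weightedSum-applyUpTo-+ f f′ (suc n) g = trans
  (cong₂ _+_ (*-distribʳ-+ (g 0) (f 0) (f′ 0))
             (weightedSum-applyUpTo-+ (f ∘ suc) (f′ ∘ suc) n (g ∘ suc)))
  (interchange (f 0 * g 0) (f′ 0 * g 0) _ _)

weightedSum-0 : ∀ n g → weightedSum (applyUpTo (λ _ → 0) n) g ≡ 0
weightedSum-0 zero    g = refl
weightedSum-0 (suc n) g = weightedSum-0 n (g ∘ suc)

δ : ℕ → ℕ → ℕ
δ zero    zero    = 1
δ zero    (suc _) = 0
δ (suc _) zero    = 0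
δ (suc i) (suc j) = δ i j

δ-≡ : ∀ i → δ i i ≡ 1
δ-≡ zero    = refl
δ-≡ (suc i) = δ-≡ i

δ-≢ : ∀ {i j} → i ≢ j → δ i j ≡ 0
δ-≢ {zero}  {zero}  i≢j = contradiction refl i≢j
δ-≢ {zero}  {suc j} i≢j = refl
δ-≢ {suc i} {zero}  i≢j = refl
δ-≢ {suc i} {suc j} i≢j = δ-≢ (i≢j ∘ cong suc)

weightedSum-δ : ∀ {i n} g → i < n → weightedSum (applyUpTo (δ i) n) g ≡ g i
weightedSum-δ {zero}  {suc n} g _         =
  trans (cong₂ _+_ (*-identityˡ (g 0)) (weightedSum-0 n (g ∘ suc))) (+-identityʳ (g 0))
weightedSum-δ {suc i} {suc n} g (s≤s i<n) = weightedSum-δ (g ∘ suc) i<n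

module _ (rank : A → ℕ) where

  countRank : ℕ → List A → ℕ
  countRank m = count (λ x → rank x ℕ.≟ m)

  countRank-∷ : ∀ m x xs → countRank m (x ∷ xs) ≡ δ (rank x) m + countRank m xs
  countRank-∷ m x xs with rank x ℕ.≟ m
  ... | yes refl = trans (cong length (filter-accept (λ y → rank y ℕ.≟ m) refl))
                         (cong (_+ countRank m xs) (sym (δ-≡ m)))
  ... | no  ≢m   = trans (cong length (filter-reject (λ y → rank y ℕ.≟ m) ≢m))
                         (cong (_+ countRank m xs) (sym (δ-≢ ≢m)))

  -- Double counting: grouping the entries by rank does not change the sum. Each new entry `x` adds
  -- the sequence `δ (rank x)` to the counts, and the bound on the ranks keeps its single 1 inside
  -- the first `n` terms.
  weightedSum-countRank : ∀ g {n xs} → All (λ x → rank x < n) xs →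
    weightedSum (applyUpTo (λ m → countRank m xs) n) g ≡ sum (map (g ∘ rank) xs)
  weightedSum-countRank g {n} []                = weightedSum-0 n g
  weightedSum-countRank g {n} {x ∷ xs} (x< ∷ xs<) = begin
    weightedSum (applyUpTo (λ m → countRank m (x ∷ xs)) n) g
      ≡⟨ cong (λ W → weightedSum W g) (applyUpTo-cong (λ m → countRank-∷ m x xs) n) ⟩
    weightedSum (applyUpTo (λ m → δ (rank x) m + countRank m xs) n) g
      ≡⟨ weightedSum-applyUpTo-+ (δ (rank x)) _ n g ⟩
    weightedSum (applyUpTo (δ (rank x)) n) g + weightedSum (applyUpTo (λ m → countRank m xs) n) g
      ≡⟨ cong₂ _+_ (weightedSum-δ g x<) (weightedSum-countRank g xs<) ⟩
    g (rank x) + sum (map (g ∘ rank) xs) ∎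
    where open ≡-Reasoning

-- Coefficients of the Horner evaluations

open RawMonoidDefs ℕ[x].+-rawMonoid using () renaming (_×_ to _·ₓ_)
open RawMonoidDefs ℕ[x,y].+-rawMonoid using () renaming (_×_ to _·ₓᵧ_)

coeffₓ : ℕ[x].Carrier → ℕ → ℕ
coeffₓ = coeff +-*-rawSemiring

coeffₓᵧ : ℕ[x,y].Carrier → ℕ → ℕ → ℕ
coeffₓᵧ p d = coeffₓ (coeff ℕ[x] p d)

coeffₓ-+ : ∀ p q k → coeffₓ (p ℕ[x].+ q) k ≡ coeffₓ p k + coeffₓ q k
coeffₓ-+ []      q       k       = refl
coeffₓ-+ (a ∷ p) []      k       = sym (+-identityʳ _)
coeffₓ-+ (a ∷ p) (b ∷ q) zero    = refl
coeffₓ-+ (a ∷ p) (b ∷ q) (suc k) = coeffₓ-+ p q k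

coeffₓ-scale : ∀ a p k → coeffₓ (map (a *_) p) k ≡ a * coeffₓ p k
coeffₓ-scale a []      k       = sym (*-zeroʳ a)
coeffₓ-scale a (b ∷ p) zero    = refl
coeffₓ-scale a (b ∷ p) (suc k) = coeffₓ-scale a p k

coeffₓ-0∷[] : ∀ k → coeffₓ (0 ∷ []) k ≡ 0
coeffₓ-0∷[] zero    = refl
coeffₓ-0∷[] (suc k) = refl

coeffₓ-const : ∀ a p k → coeffₓ ((a ∷ []) ℕ[x].* p) k ≡ a * coeffₓ p k
coeffₓ-const a p k = begin
  coeffₓ ((a ∷ []) ℕ[x].* p) k                   ≡⟨ coeffₓ-+ (map (a *_) p) (0 ∷ []) k ⟩
  coeffₓ (map (a *_) p) k + coeffₓ (0 ∷ []) k    ≡⟨ cong₂ _+_ (coeffₓ-scale a p k) (coeffₓ-0∷[] k) ⟩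
  a * coeffₓ p k + 0                             ≡⟨ +-identityʳ _ ⟩
  a * coeffₓ p k                                 ∎
  where open ≡-Reasoning

coeffₓ-linear-zero : ∀ a b p → coeffₓ ((a ∷ b ∷ []) ℕ[x].* p) 0 ≡ a * coeffₓ p 0
coeffₓ-linear-zero a b p = trans (coeffₓ-+ (map (a *_) p) _ 0)
  (trans (+-identityʳ _) (coeffₓ-scale a p 0))

coeffₓ-linear-suc : ∀ a b p k →
  coeffₓ ((a ∷ b ∷ []) ℕ[x].* p) (suc k) ≡ a * coeffₓ p (suc k) + b * coeffₓ p k
coeffₓ-linear-suc a b p k = trans (coeffₓ-+ (map (a *_) p) _ (suc k))
  (cong₂ _+_ (coeffₓ-scale a p (suc k)) (coeffₓ-const b p k))

coeffₓ-·1 : ∀ a k → coeffₓ (a ·ₓ ℕ[x].1#) k ≡ a * coeffₓ ℕ[x].1# k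
coeffₓ-·1 zero    k = refl
coeffₓ-·1 (suc a) k = trans (coeffₓ-+ ℕ[x].1# (a ·ₓ ℕ[x].1#) k)
                            (cong (coeffₓ ℕ[x].1# k +_) (coeffₓ-·1 a k))

-- The binomial theorem for `(x + 1)ᵐ`, summed over `m`. The polynomial `x + 1` reduces to
-- `1 ∷ 1 ∷ []`, so one Horner step adds two consecutive coefficients, and Pascal's rule raises `m`
-- to `suc m`.
evaluate-x+1 : ∀ W k → coeffₓ (evaluate ℕ[x] W (ℕ[x].x ℕ[x].+ ℕ[x].1#)) k ≡ weightedSum W (_C k)
evaluate-x+1 []      k       = refl
evaluate-x+1 (w ∷ W) zero    = begin
  coeffₓ (w ·ₓ ℕ[x].1# ℕ[x].+ (1 ∷ 1 ∷ []) ℕ[x].* E) 0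
    ≡⟨ coeffₓ-+ (w ·ₓ ℕ[x].1#) _ 0 ⟩
  coeffₓ (w ·ₓ ℕ[x].1#) 0 + coeffₓ ((1 ∷ 1 ∷ []) ℕ[x].* E) 0
    ≡⟨ cong₂ _+_ (coeffₓ-·1 w 0) (coeffₓ-linear-zero 1 1 E) ⟩
  w * 1 + 1 * coeffₓ E 0
    ≡⟨ cong (w * 1 +_) (trans (*-identityˡ _) (evaluate-x+1 W 0)) ⟩
  w * 1 + weightedSum W (_C 0)
    ≡⟨ cong (w * 1 +_) (weightedSum-cong W λ m → trans (nC0≡1 m) (sym (nC0≡1 (suc m)))) ⟩
  w * 1 + weightedSum W (λ m → suc m C 0) ∎
  where
  open ≡-Reasoning
  E = evaluate ℕ[x] W (ℕ[x].x ℕ[x].+ ℕ[x].1#)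
evaluate-x+1 (w ∷ W) (suc k) = begin
  coeffₓ (w ·ₓ ℕ[x].1# ℕ[x].+ (1 ∷ 1 ∷ []) ℕ[x].* E) (suc k)
    ≡⟨ coeffₓ-+ (w ·ₓ ℕ[x].1#) _ (suc k) ⟩
  coeffₓ (w ·ₓ ℕ[x].1#) (suc k) + coeffₓ ((1 ∷ 1 ∷ []) ℕ[x].* E) (suc k)
    ≡⟨ cong₂ _+_ (coeffₓ-·1 w (suc k)) (coeffₓ-linear-suc 1 1 E k) ⟩
  w * 0 + (1 * coeffₓ E (suc k) + 1 * coeffₓ E k)
    ≡⟨ cong (w * 0 +_) (cong₂ _+_ (trans (*-identityˡ _) (evaluate-x+1 W (suc k)))
                                  (trans (*-identityˡ _) (evaluate-x+1 W k))) ⟩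
  w * 0 + (weightedSum W (_C suc k) + weightedSum W (_C k))
    ≡⟨ cong (w * 0 +_) (weightedSum-+ W (_C suc k) (_C k)) ⟨
  w * 0 + weightedSum W (λ m → m C suc k + m C k)
    ≡⟨ cong (w * 0 +_) (weightedSum-cong W λ m →
         trans (+-comm (m C suc k) (m C k)) (nCk+nC[k+1]≡[n+1]C[k+1] m k)) ⟩
  w * 0 + weightedSum W (λ m → suc m C suc k) ∎
  where
  open ≡-Reasoning
  E = evaluate ℕ[x] W (ℕ[x].x ℕ[x].+ ℕ[x].1#)

coeffₓᵧ-+ : ∀ p q d k → coeffₓᵧ (p ℕ[x,y].+ q) d k ≡ coeffₓᵧ p d k + coeffₓᵧ q d k
coeffₓᵧ-+ []      q       d       k = refl
coeffₓᵧ-+ (a ∷ p) []      d       k = sym (+-identityʳ _)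
coeffₓᵧ-+ (a ∷ p) (b ∷ q) zero    k = coeffₓ-+ a b k
coeffₓᵧ-+ (a ∷ p) (b ∷ q) (suc d) k = coeffₓᵧ-+ p q d k

coeffₓ-*[] : ∀ c k → coeffₓ (c ℕ[x].* []) k ≡ 0
coeffₓ-*[] []      k       = refl
coeffₓ-*[] (a ∷ c) zero    = refl
coeffₓ-*[] (a ∷ c) (suc k) = coeffₓ-*[] c k

coeffₓᵧ-scale : ∀ c p d k →
  coeffₓᵧ (map (c ℕ[x].*_) p) d k ≡ coeffₓ (c ℕ[x].* coeff ℕ[x] p d) k
coeffₓᵧ-scale c []      d       k = sym (coeffₓ-*[] c k)
coeffₓᵧ-scale c (a ∷ p) zero    k = refl
coeffₓᵧ-scale c (a ∷ p) (suc d) k = coeffₓᵧ-scale c p d k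

coeffₓᵧ-[]∷[] : ∀ d k → coeffₓᵧ ([] ∷ []) d k ≡ 0
coeffₓᵧ-[]∷[] zero    k = refl
coeffₓᵧ-[]∷[] (suc d) k = refl

coeffₓᵧ-·1 : ∀ a d k → coeffₓᵧ (a ·ₓᵧ ℕ[x,y].1#) d k ≡ a * coeffₓᵧ ℕ[x,y].1# d k
coeffₓᵧ-·1 zero    d k = refl
coeffₓᵧ-·1 (suc a) d k = trans (coeffₓᵧ-+ ℕ[x,y].1# (a ·ₓᵧ ℕ[x,y].1#) d k)
                               (cong (coeffₓᵧ ℕ[x,y].1# d k +_) (coeffₓᵧ-·1 a d k))

module _ (p : ℕ[x,y].Carrier) where
  open ≡-Reasoning

  private
    x+y = ℕ[x,y].x ℕ[x,y].+ ℕ[x,y].y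
    x·p = map (ℕ[x].x ℕ[x].*_) p
    1·p = map (ℕ[x].1# ℕ[x].*_) p

  coeffₓᵧ-x·-zero : ∀ d → coeffₓᵧ x·p d 0 ≡ 0
  coeffₓᵧ-x·-zero d = trans (coeffₓᵧ-scale ℕ[x].x p d 0) (coeffₓ-linear-zero 0 1 (coeff ℕ[x] p d))

  coeffₓᵧ-x·-suc : ∀ d k → coeffₓᵧ x·p d (suc k) ≡ coeffₓᵧ p d k
  coeffₓᵧ-x·-suc d k = trans (coeffₓᵧ-scale ℕ[x].x p d (suc k))
    (trans (coeffₓ-linear-suc 0 1 (coeff ℕ[x] p d) k) (*-identityˡ _))

  -- By powers of `y`, the polynomial `x + y` reduces to the list of `x` and `1#`. Multiplying by it
  -- adds `x·p` to `p` shifted by one power of `y`; the shift is absent at index 0.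
  [x+y]·-zero : ∀ k → coeffₓᵧ (x+y ℕ[x,y].* p) 0 k ≡ coeffₓᵧ x·p 0 k
  [x+y]·-zero k = trans (coeffₓᵧ-+ x·p _ 0 k) (+-identityʳ _)

  [x+y]·-suc : ∀ d k → coeffₓᵧ (x+y ℕ[x,y].* p) (suc d) k ≡ coeffₓᵧ x·p (suc d) k + coeffₓᵧ p d k
  [x+y]·-suc d k = trans (coeffₓᵧ-+ x·p _ (suc d) k) (cong (coeffₓᵧ x·p (suc d) k +_) (begin
    -- The summand `[] ∷ []` is the zero polynomial that `mulPoly` leaves after its last
    -- coefficient.
    coeffₓᵧ (1·p ℕ[x,y].+ ([] ∷ [])) d k          ≡⟨ coeffₓᵧ-+ 1·p ([] ∷ []) d k ⟩
    coeffₓᵧ 1·p d k + coeffₓᵧ ([] ∷ []) d k       ≡⟨ cong₂ _+_ (coeffₓᵧ-scale ℕ[x].1# p d k) (coeffₓᵧ-[]∷[] d k) ⟩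
    coeffₓ (ℕ[x].1# ℕ[x].* coeff ℕ[x] p d) k + 0  ≡⟨ +-identityʳ _ ⟩
    coeffₓ (ℕ[x].1# ℕ[x].* coeff ℕ[x] p d) k      ≡⟨ coeffₓ-const 1 (coeff ℕ[x] p d) k ⟩
    1 * coeffₓᵧ p d k                             ≡⟨ *-identityˡ _ ⟩
    coeffₓᵧ p d k                                 ∎))

-- The polynomial `(x + y)ᵐ` is homogeneous, so only `m = k + d` contributes to the monomial with
-- exponents `k` and `d`.
evaluate-x+y : ∀ W d k → coeffₓᵧ (evaluate ℕ[x,y] W (ℕ[x,y].x ℕ[x,y].+ ℕ[x,y].y)) d k ≡
                         coeffₓ W (k + d) * ((k + d) C k)
evaluate-x+y []      d k = refl
evaluate-x+y (w ∷ W) d k = trans (coeffₓᵧ-+ (w ·ₓᵧ ℕ[x,y].1#) (x+y ℕ[x,y].* E) d k)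
  (trans (cong (_+ coeffₓᵧ (x+y ℕ[x,y].* E) d k) (coeffₓᵧ-·1 w d k)) (horner d k))
  where
  open ≡-Reasoning
  x+y = ℕ[x,y].x ℕ[x,y].+ ℕ[x,y].y
  E = evaluate ℕ[x,y] W x+y

  horner : ∀ d k → w * coeffₓᵧ ℕ[x,y].1# d k + coeffₓᵧ (x+y ℕ[x,y].* E) d k ≡
                   coeffₓ (w ∷ W) (k + d) * ((k + d) C k)
  horner zero zero = begin
    w * 1 + coeffₓᵧ (x+y ℕ[x,y].* E) 0 0
      ≡⟨ cong (w * 1 +_) (trans ([x+y]·-zero E 0) (coeffₓᵧ-x·-zero E 0)) ⟩
    w * 1 + 0  ≡⟨ +-identityʳ _ ⟩
    w * 1      ∎
  horner zero (suc k) = begin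
    w * 0 + coeffₓᵧ (x+y ℕ[x,y].* E) 0 (suc k)
      ≡⟨ cong₂ _+_ (*-zeroʳ w) (trans ([x+y]·-zero E (suc k)) (coeffₓᵧ-x·-suc E 0 k)) ⟩
    coeffₓᵧ E 0 k
      ≡⟨ evaluate-x+y W 0 k ⟩
    coeffₓ W (k + 0) * ((k + 0) C k)
      -- Both binomials have equal upper and lower index, up to `+-identityʳ`, and are 1.
      ≡⟨ cong (coeffₓ W (k + 0) *_) diagonal ⟩
    coeffₓ W (k + 0) * (suc (k + 0) C suc k) ∎
    where
    diagonal : (k + 0) C k ≡ suc (k + 0) C suc k
    diagonal rewrite +-identityʳ k = trans (nCn≡1 k) (sym (nCn≡1 (suc k)))
  horner (suc d) zero = begin
    w * 0 + coeffₓᵧ (x+y ℕ[x,y].* E) (suc d) 0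
      ≡⟨ cong₂ _+_ (*-zeroʳ w) (trans ([x+y]·-suc E d 0)
           (cong (_+ coeffₓᵧ E d 0) (coeffₓᵧ-x·-zero E (suc d)))) ⟩
    coeffₓᵧ E d 0
      ≡⟨ evaluate-x+y W d 0 ⟩
    coeffₓ W d * (d C 0)
      ≡⟨ cong (coeffₓ W d *_) (trans (nC0≡1 d) (sym (nC0≡1 (suc d)))) ⟩
    coeffₓ W d * (suc d C 0) ∎
  horner (suc d) (suc k) = begin
    w * 0 + coeffₓᵧ (x+y ℕ[x,y].* E) (suc d) (suc k)
      ≡⟨ cong₂ _+_ (*-zeroʳ w) (trans ([x+y]·-suc E d (suc k))
           (cong (_+ coeffₓᵧ E d (suc k)) (coeffₓᵧ-x·-suc E (suc d) k))) ⟩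
    coeffₓᵧ E (suc d) k + coeffₓᵧ E d (suc k)
      ≡⟨ cong₂ _+_ (evaluate-x+y W (suc d) k) (evaluate-x+y W d (suc k)) ⟩
    coeffₓ W (k + suc d) * ((k + suc d) C k) + coeffₓ W (suc k + d) * ((suc k + d) C suc k)
      -- The second index arrives as `suc k + d` and has to become `k + suc d` before Pascal's rule
      -- applies.
      ≡⟨ cong (λ m → coeffₓ W (k + suc d) * ((k + suc d) C k) + coeffₓ W m * (m C suc k)) (+-suc k d) ⟨
    coeffₓ W (k + suc d) * ((k + suc d) C k) + coeffₓ W (k + suc d) * ((k + suc d) C suc k)
      ≡⟨ *-distribˡ-+ (coeffₓ W (k + suc d)) _ _ ⟨
    coeffₓ W (k + suc d) * ((k + suc d) C k + (k + suc d) C suc k)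
      ≡⟨ cong (coeffₓ W (k + suc d) *_) (nCk+nC[k+1]≡[n+1]C[k+1] (k + suc d) k) ⟩
    coeffₓ W (k + suc d) * (suc (k + suc d) C suc k) ∎

-- Daisy cubes

module Daisy {n} {X : Pred (Word n) 0ℓ} (X? : Decidable X) (X≢∅ : Satisfiable X) where

  G : Graph
  G = daisyCube X?

  open Graph G using (V; vertices; complete; unique; order; _≟_; _~_)
  open DecMembership _≟_ using (_∈?_)

  0ⁿ : V
  0ⁿ = daisyZero X? X≢∅

  ∣_∣ : V → ℕ
  ∣ v ∣ = weight (value v)

  -- Downward closure and distance from the zero word

  below-closed : u ≼ v → Below X? v → Below X? u
  below-closed u≼v (x , x∈X , v≼x) = x , x∈X , ≼-trans u≼v v≼x

  -- Membership in the daisy cube is stored irrelevantly, so the order proof can be irrelevant too,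
  -- and the vertex depends on the word alone.
  shrink : (v : V) (u : Word n) → .(u ≼ value v) → V
  shrink (_ , [ v∈D ]) u u≼v = u , [ below-closed u≼v v∈D ]

  0ⁿ-unique : (v : V) → ∣ v ∣ ≡ 0 → v ≡ 0ⁿ
  0ⁿ-unique v e = value-injective (weight≡0 (value v) e)

  descend : ∀ {m} (v : V) → ∣ v ∣ ≡ suc m → ∃ λ u → ∣ u ∣ ≡ m × u ~ v
  descend v e with i , p , q ← lower (value v) e =
    shrink v _ p , q , Graph.~-sym (Q n) {value v} {flip i (value v)} (flip-adjacent i (value v))

  snoc : ∀ {u v w l} → Walk G u v l → v ~ w → Walk G u w (suc l)
  snoc []      e = e ∷ []
  snoc (d ∷ p) e = d ∷ snoc p e

  -- The ones of `v` are raised one at a time; all intermediate words lie below `v`, so the walk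
  -- stays in the daisy cube.
  walk-from-0ⁿ : ∀ m v → ∣ v ∣ ≡ m → Walk G 0ⁿ v m
  walk-from-0ⁿ zero    v e with refl ← 0ⁿ-unique v e = []
  walk-from-0ⁿ (suc m) v e with u , e′ , u~v ← descend v e = snoc (walk-from-0ⁿ m u e′) u~v

  -- Each edge flips one letter and so raises the weight by at most one.
  walk-length : ∀ {u v l} → Walk G u v l → ∣ v ∣ ≤ l + ∣ u ∣
  walk-length []                        = ≤-refl
  walk-length {u} {v} (_∷_ {v = w} {l = l} e p) = begin
    ∣ v ∣           ≤⟨ walk-length p ⟩
    l + ∣ w ∣       ≡⟨ cong (λ x → l + weight x) (adjacent-flip (value u) (value w) e) ⟩
    l + weight (flip (proj₁ e) (value u)) ≤⟨ +-monoʳ-≤ l (weight-flip (proj₁ e) (value u)) ⟩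
    l + suc ∣ u ∣   ≡⟨ +-suc l ∣ u ∣ ⟩
    suc l + ∣ u ∣   ∎
    where open ≤-Reasoning

  walk-length₀ : ∀ {v l} → Walk G 0ⁿ v l → ∣ v ∣ ≤ l
  walk-length₀ {l = l} p =
    subst (_ ≤_) (trans (cong (l +_) (weight-zeroWord n)) (+-identityʳ l)) (walk-length p)

  dist⇔weight : ∀ v d → Dist G 0ⁿ v d ⇔ ∣ v ∣ ≡ d
  dist⇔weight v d = mk⇔
    (λ (p , min) → ≤-antisym (walk-length₀ p) (min (walk-from-0ⁿ ∣ v ∣ v refl)))
    (λ { refl → walk-from-0ⁿ ∣ v ∣ v refl , walk-length₀ })

  below-of-weight : ∀ m (v : V) → ∣ v ∣ ≡ m → ∀ {j} → j ≤ m → ∃ λ u → ∣ u ∣ ≡ j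
  below-of-weight zero    v e z≤n = v , e
  below-of-weight (suc m) v e {j} j≤ with m≤n⇒m<n∨m≡n j≤
  ... | inj₂ refl = v , e
  ... | inj₁ (s≤s j≤m) with u , e′ , _ ← descend v e = below-of-weight m u e′ j≤m

  -- By descent there are vertices of every weight from 0 to `∣ v ∣`; they occupy different
  -- positions in `vertices`, and the pigeonhole principle gives the bound. It is what makes
  -- truncating the polynomials at `order` harmless.
  weight<order : ∀ v → ∣ v ∣ < order
  weight<order v = Fin.injective⇒≤ {f = position} position-injective
    where
    at : (j : Fin (suc ∣ v ∣)) → ∃ λ u → ∣ u ∣ ≡ toℕ j
    at j = below-of-weight ∣ v ∣ v refl (Fin.toℕ≤pred[n] j)

    position : Fin (suc ∣ v ∣) → Fin order
    position j = index (complete (proj₁ (at j)))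

    position-injective : ∀ {i j} → position i ≡ position j → i ≡ j
    position-injective {i} {j} e = Fin.toℕ-injective (begin
      toℕ i                              ≡⟨ proj₂ (at i) ⟨
      ∣ proj₁ (at i) ∣                   ≡⟨ cong ∣_∣ (lookup-index (complete _)) ⟩
      ∣ List.lookup vertices (position i) ∣   ≡⟨ cong (∣_∣ ∘ List.lookup vertices) e ⟩
      ∣ List.lookup vertices (position j) ∣   ≡⟨ cong ∣_∣ (lookup-index (complete _)) ⟨
      ∣ proj₁ (at j) ∣                   ≡⟨ proj₂ (at j) ⟩
      toℕ j                              ∎)
      where open ≡-Reasoning

  -- Induced cubes are intervals

  box : Word n → Word n → List V
  box a b = filter (λ v → between? a b (value v)) vertices

  box⁺ : ∀ v → Between a b (value v) → v ∈ box a b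
  box⁺ v p = ∈-filter⁺ _ (complete v) p

  box⁻ : ∀ {v} → v ∈ box a b → Between a b (value v)
  box⁻ v∈ = proj₂ (∈-filter⁻ _ {xs = vertices} v∈)

  bottom∈box : ∀ b (p : a ≼ value b) → shrink b a p ∈ box a (value b)
  bottom∈box b p = box⁺ (shrink b _ p) (≼-refl _ , p)

  top∈box : ∀ b → a ≼ value b → b ∈ box a (value b)
  top∈box b p = box⁺ b (p , ≼-refl _)

  -- The ends are the least and the greatest element of the interval. Each end belongs to the other
  -- interval, and antisymmetry identifies them.
  box-injective : ∀ {a a′ b b′} → a ≼ value b → a′ ≼ value b′ →
                  box a (value b) ≡ box a′ (value b′) → a ≡ a′ × b ≡ b′
  box-injective {a} {a′} {b} {b′} p p′ e =
    ≼-antisym (proj₁ (box⁻ (subst (shrink b′ a′ p′ ∈_) (sym e) (bottom∈box {a′} b′ p′))))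
              (proj₁ (box⁻ (subst (shrink b a p ∈_) e (bottom∈box b p)))) ,
    value-injective (≼-antisym (proj₂ (box⁻ (subst (b ∈_) e (top∈box b p))))
                               (proj₂ (box⁻ (subst (b′ ∈_) (sym e) (top∈box b′ p′)))))

  -- On the interval `project` and `embed` are inverse and preserve Hamming distance, hence
  -- adjacency. Embedded words are vertices because they lie below `b`.
  box≅cube : ∀ {b} → Face k a (value b) → inducedOn G (box a (value b)) ≅ Q k
  box≅cube {k} {a} {b} F = record
    { bijection = mk↔ₛ′ coordinates point
        (project-embed F)
        (λ x → value-injective (value-injective (embed-project F (between x))))
    ; adjacency = λ x y → mk⇔
        (λ x~y → hamming⇒adjacent (coordinates x) (coordinates y)
          (trans (sym (isometric x y)) (adjacent⇒hamming (value (value x)) (value (value y)) x~y)))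
        (λ x~y → hamming⇒adjacent (value (value x)) (value (value y))
          (trans (isometric x y) (adjacent⇒hamming (coordinates x) (coordinates y) x~y)))
    }
    where
    S = box a (value b)
    H = inducedOn G S

    between : (x : Graph.V H) → Between a (value b) (value (value x))
    -- Membership in `S` is stored irrelevantly; deciding it recovers a usable proof.
    between (v , [ v∈S ]) = box⁻ (recompute (v ∈? S) v∈S)

    coordinates : Graph.V H → Word k
    coordinates x = project F (value (value x))

    point : Word k → Graph.V H
    point w = image , [ box⁺ image (embed-between F w) ]
      where image = shrink b (embed F w) (proj₂ (embed-between F w))

    isometric : ∀ x y → hamming (value (value x)) (value (value y)) ≡
                        hamming (coordinates x) (coordinates y)
    isometric x y = begin
      hamming (value (value x)) (value (value y))
        ≡⟨ cong₂ hamming (embed-project F (between x)) (embed-project F (between y)) ⟨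
      hamming (embed F (coordinates x)) (embed F (coordinates y))
        ≡⟨ hamming-embed F _ _ ⟩
      hamming (coordinates x) (coordinates y) ∎
      where open ≡-Reasoning

  -- The inverse isomorphism followed by the inclusion into `Q n` is an injective homomorphism, so
  -- `image-face` applies, and `sublist≡filter` recovers `S` from its members.
  cube⇒box : ∀ {S} → S ∈ sublists vertices → inducedOn G S ≅ Q k →
             ∃₂ λ a b → Face k a (value b) × S ≡ box a (value b)
  cube⇒box {k} {S} S∈ iso =
    bottom , value (point zenith) , subst (Face k bottom) (sym top≡) face ,
    trans (sublist≡filter (between? bottom top ∘ value) unique S∈ λ _ → mk⇔ inside outside)
          (cong (box bottom) (sym top≡))
    where
    open _≅_ iso using (bijection; adjacency)
    module I = Inverse bijection
    H = inducedOn G S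

    point : Word k → Graph.V H
    point = I.from

    f : Word k → Word n
    f w = value (value (point w))

    f-injective : ∀ {v w} → f v ≡ f w → v ≡ w
    f-injective {v} {w} e = begin
      v               ≡⟨ I.strictlyInverseˡ v ⟨
      I.to (point v)  ≡⟨ cong I.to (value-injective (value-injective e)) ⟩
      I.to (point w)  ≡⟨ I.strictlyInverseˡ w ⟩
      w               ∎
      where open ≡-Reasoning

    f-flip : ∀ i v → ∃ λ j → f (flip i v) ≡ flip j (f v)
    f-flip i v = _ , adjacent-flip (f v) (f (flip i v)) (from (adjacency (point v) (point (flip i v)))
      (subst₂ Adjacent (sym (I.strictlyInverseˡ v)) (sym (I.strictlyInverseˡ (flip i v)))
        (flip-adjacent i v)))

    open Image (image-face f f-injective f-flip)

    -- The coordinates of the point sent to `top`; they exhibit `top` as the word of a vertex of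
    -- `G`.
    zenith : Word k
    zenith = proj₁ (onto (face-≼ face , ≼-refl top))

    top≡ : f zenith ≡ top
    top≡ = proj₂ (onto (face-≼ face , ≼-refl top))

    inside : ∀ {v} → v ∈ S → Between bottom top (value v)
    inside {v} v∈S = subst (Between bottom top ∘ value ∘ value)
                           (I.strictlyInverseʳ (v , [ v∈S ])) (into (I.to (v , [ v∈S ])))

    outside : ∀ {v} → Between bottom top (value v) → v ∈ S
    outside {v} p with w , e ← onto p =
      subst (_∈ S) (value-injective e) (member (point w))
      where
      member : (x : Graph.V H) → value x ∈ S
      member (x , [ x∈S ]) = recompute (x ∈? S) x∈S

  -- Distance from `0ⁿ` is weight, and weight is monotone, so the bottom of the interval is its
  -- nearest point.
  distTo⇔weight : ∀ {a b} → a ≼ value b → ∀ d → DistTo G 0ⁿ (box a (value b)) d ⇔ weight a ≡ d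
  distTo⇔weight {a} {b} a≼b d = mk⇔
    (λ (p , min) → ≤-antisym (far p) (min near))
    (λ { refl → near , far })
    where
    Reached : ℕ → Set
    Reached d = Any (λ v → Dist G 0ⁿ v d) (box a (value b))

    near : Reached (weight a)
    near = lose (bottom∈box b a≼b) (from (dist⇔weight (shrink b a a≼b) (weight a)) refl)

    far : ∀ {d} → Reached d → weight a ≤ d
    far p with v , v∈ , q ← find p =
      subst (weight a ≤_) (to (dist⇔weight v _) q) (weight-mono (proj₁ (box⁻ v∈)))

  -- Counting the intervals by their top

  boxesUnder : ℕ → V → List (List V)
  boxesUnder k b = map (λ a → box a (value b)) (lowerEnds (value b) k)

  boxesUnder⁻ : ∀ k b {S} → S ∈ boxesUnder k b →
                ∃ λ a → Face k a (value b) × S ≡ box a (value b)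
  boxesUnder⁻ k b S∈ with a , a∈ , e ← ∈-map⁻ _ S∈ = a , lowerEnds⁻ (value b) k a∈ , e

  boxes : ℕ → List V → List (List V)
  boxes k = concatMap (boxesUnder k)

  boxes⁺ : ∀ {bs a b} → b ∈ bs → Face k a (value b) → box a (value b) ∈ boxes k bs
  boxes⁺ {k} b∈ F = ∈-concatMap⁺ (boxesUnder k) (lose b∈ (∈-map⁺ _ (lowerEnds⁺ F)))

  boxes⁻ : ∀ {bs S} → S ∈ boxes k bs →
           ∃₂ λ a b → b ∈ bs × Face k a (value b) × S ≡ box a (value b)
  boxes⁻ {k} {bs} S∈
    with b , b∈ , S∈′ ← find (∈-concatMap⁻ (boxesUnder k) {bs} S∈)
    with a , F , e ← boxesUnder⁻ k b S∈′ = a , b , b∈ , F , e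

  boxes-unique : ∀ k {bs} → Unique bs → Unique (boxes k bs)
  boxes-unique k bs! = concatMap-unique (boxesUnder k) bs!
    (λ b → map-unique _ (lowerEnds-unique (value b) k) λ a∈ a∈′ e →
      proj₁ (box-injective {b = b} {b} (face-≼ (lowerEnds⁻ (value b) k a∈))
                           (face-≼ (lowerEnds⁻ (value b) k a∈′)) e))
    (λ {b} {b′} S∈ S∈′ →
      let a  , F  , e  = boxesUnder⁻ k b S∈
          a′ , F′ , e′ = boxesUnder⁻ k b′ S∈′
      in proj₂ (box-injective (face-≼ F) (face-≼ F′) (trans (sym e) e′)))

  length-boxes : ∀ k bs → length (boxes k bs) ≡ sum (map (λ b → ∣ b ∣ C k) bs)
  length-boxes k bs = trans (length-concatMap (boxesUnder k) bs)
    (cong sum (map-cong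
      (λ b → trans (length-map _ (lowerEnds (value b) k)) (length-lowerEnds (value b) k)) bs))

  -- The common core of both counts: for `cubes` the tops `bs` are all vertices, for `cubesAt` those
  -- of weight `k + d`. The selected sublists and the boxes form duplicate-free lists with the same
  -- members, hence of the same length.
  count-boxes : {P : Pred (List V) 0ℓ} (P? : Decidable P) (k : ℕ) {bs : List V} → Unique bs →
                (∀ {S} → S ∈ sublists vertices → P S → S ∈ boxes k bs) →
                (∀ {a b} → b ∈ bs → Face k a (value b) → P (box a (value b))) →
                count P? (sublists vertices) ≡ sum (map (λ b → ∣ b ∣ C k) bs)
  count-boxes P? k {bs} bs! sound complete′ = trans
    (unique-length (Unique.filter⁺ P? (sublists-unique unique)) (boxes-unique k bs!) (mk⇔
      (λ S∈ → let S∈′ , p = ∈-filter⁻ P? S∈ in sound S∈′ p)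
      (λ S∈ → case boxes⁻ S∈ of λ { (a , b , b∈ , F , refl) →
        ∈-filter⁺ P? (filter∈sublists _ vertices) (complete′ b∈ F) })))
    (length-boxes k bs)

  cubes≡ : ∀ k → cubes G k ≡ sum (map (λ v → ∣ v ∣ C k) vertices)
  cubes≡ k = count-boxes _ k unique
    (λ S∈ iso → case cube⇒box S∈ iso of λ { (a , b , F , refl) → boxes⁺ (complete b) F })
    (λ {a} {b} _ → box≅cube {b = b})

  cubesAt≡ : ∀ k d → cubesAt G 0ⁿ k d ≡ verticesAt G 0ⁿ (k + d) * ((k + d) C k)
  cubesAt≡ k d = trans
    (count-boxes _ k (Unique.filter⁺ top? unique)
      (λ S∈ (iso , dist) → case cube⇒box S∈ iso of λ { (a , b , F , refl) →
        boxes⁺ (∈-filter⁺ top? (complete b) (from (dist⇔weight b (k + d))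
          (trans (face-weight F) (cong (k +_) (to (distTo⇔weight {b = b} (face-≼ F) d) dist))))) F })
      (λ {a} {b} b∈ F → box≅cube {b = b} F , from (distTo⇔weight {b = b} (face-≼ F) d)
        -- A `k`-face whose top has weight `k + d` has a bottom of weight `d`.
        (+-cancelˡ-≡ k _ _ (trans (sym (face-weight F))
          (to (dist⇔weight b (k + d)) (proj₂ (∈-filter⁻ top? {xs = vertices} b∈)))))))
    -- All tops have weight `k + d`, so each contributes the same binomial.
    (sum-constant _ (All.map (λ {v} p → cong (_C k) (to (dist⇔weight v (k + d)) p))
                             (All.all-filter top? vertices)))
    where
    top? : Decidable (λ v → Dist G 0ⁿ v (k + d))
    top? v = dist? G 0ⁿ v (k + d)

  -- Truncation and comparison of coefficients

  verticesAt≡ : ∀ d → verticesAt G 0ⁿ d ≡ countRank ∣_∣ d vertices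
  verticesAt≡ d = cong length (filter-≐ _ _
    ((λ {v} → to (dist⇔weight v d)) , (λ {v} → from (dist⇔weight v d))) vertices)

  verticesAt-vanish : ∀ {d} → order ≤ d → verticesAt G 0ⁿ d ≡ 0
  verticesAt-vanish {d} N≤d = cong length (filter-none _ (All.universal
    (λ v p → <⇒≢ (<-≤-trans (weight<order v) N≤d) (to (dist⇔weight v d) p)) vertices))

  cubes-vanish : ∀ {k} → order ≤ k → cubes G k ≡ 0
  cubes-vanish {k} N≤k = trans (cubes≡ k) (trans
    (sum-constant _ (All.universal (λ v → k>n⇒nCk≡0 (<-≤-trans (weight<order v) N≤k)) vertices))
    (*-zeroʳ order))

  -- Bounding the sum `k + d` covers the truncation in `x` and the one in `y` at once.
  cubesAt-vanish : ∀ k d → order ≤ k + d → cubesAt G 0ⁿ k d ≡ 0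
  cubesAt-vanish k d N≤k+d =
    trans (cubesAt≡ k d) (cong (_* ((k + d) C k)) (verticesAt-vanish N≤k+d))

  coeff-distancePolynomial : ∀ m → coeffₓ (distancePolynomial G 0ⁿ) m ≡ verticesAt G 0ⁿ m
  coeff-distancePolynomial = coeff-applyUpTo +-*-rawSemiring (verticesAt G 0ⁿ) verticesAt-vanish

  coeff-cubePolynomial : ∀ k → coeffₓ (cubePolynomial G) k ≡ cubes G k
  coeff-cubePolynomial = coeff-applyUpTo +-*-rawSemiring (cubes G) cubes-vanish

  row : ℕ → ℕ[x].Carrier
  row d = applyUpTo (λ k → cubesAt G 0ⁿ k d) order

  coeff-row : ∀ d k → coeffₓ (row d) k ≡ cubesAt G 0ⁿ k d
  coeff-row d k = coeff-applyUpTo +-*-rawSemiring (λ k → cubesAt G 0ⁿ k d)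
    (λ {k} N≤k → cubesAt-vanish k d (≤-trans N≤k (m≤m+n k d))) k

  coeff-distanceCubePolynomial : ∀ d k →
    coeffₓᵧ (distanceCubePolynomial G 0ⁿ) d k ≡ cubesAt G 0ⁿ k d
  coeff-distanceCubePolynomial d k = Sum.[ inside , outside ]′ (<-≤-connex d order)
    where
    open ≡-Reasoning

    inside : d < order → coeffₓᵧ (applyUpTo row order) d k ≡ cubesAt G 0ⁿ k d
    inside d<N = begin
      coeffₓᵧ (applyUpTo row order) d k
        ≡⟨ cong (λ p → coeffₓ p k) (coeff-applyUpTo-< ℕ[x] row d<N) ⟩
      coeffₓ (row d) k
        ≡⟨ coeff-row d k ⟩
      cubesAt G 0ⁿ k d ∎

    outside : order ≤ d → coeffₓᵧ (applyUpTo row order) d k ≡ cubesAt G 0ⁿ k d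
    outside N≤d = begin
      coeffₓᵧ (applyUpTo row order) d k
        -- Past the outer truncation the default row is the zero polynomial `[]`.
        ≡⟨ cong (λ p → coeffₓ p k) (coeff-applyUpTo-≥ ℕ[x] row N≤d) ⟩
      0
        ≡⟨ cubesAt-vanish k d (≤-trans N≤d (m≤n+m d k)) ⟨
      cubesAt G 0ⁿ k d ∎

  D≈W[x+y] : distanceCubePolynomial G 0ⁿ ℕ[x,y].≈
             evaluate ℕ[x,y] (distancePolynomial G 0ⁿ) (ℕ[x,y].x ℕ[x,y].+ ℕ[x,y].y)
  D≈W[x+y] d k = begin
    coeffₓᵧ (distanceCubePolynomial G 0ⁿ) d k
      ≡⟨ coeff-distanceCubePolynomial d k ⟩
    cubesAt G 0ⁿ k d
      ≡⟨ cubesAt≡ k d ⟩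
    verticesAt G 0ⁿ (k + d) * ((k + d) C k)
      ≡⟨ cong (_* ((k + d) C k)) (coeff-distancePolynomial (k + d)) ⟨
    coeffₓ (distancePolynomial G 0ⁿ) (k + d) * ((k + d) C k)
      ≡⟨ evaluate-x+y (distancePolynomial G 0ⁿ) d k ⟨
    coeffₓᵧ (evaluate ℕ[x,y] (distancePolynomial G 0ⁿ) (ℕ[x,y].x ℕ[x,y].+ ℕ[x,y].y)) d k ∎
    where open ≡-Reasoning

  C≈W[x+1] : cubePolynomial G ℕ[x].≈
             evaluate ℕ[x] (distancePolynomial G 0ⁿ) (ℕ[x].x ℕ[x].+ ℕ[x].1#)
  C≈W[x+1] k = begin
    coeffₓ (cubePolynomial G) k
      ≡⟨ coeff-cubePolynomial k ⟩
    cubes G k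
      ≡⟨ cubes≡ k ⟩
    sum (map (λ v → ∣ v ∣ C k) vertices)
      -- The sum over vertices is regrouped by weight.
      ≡⟨ weightedSum-countRank ∣_∣ (_C k) (All.universal weight<order vertices) ⟨
    weightedSum (applyUpTo (λ m → countRank ∣_∣ m vertices) order) (_C k)
      ≡⟨ cong (λ W → weightedSum W (_C k)) (applyUpTo-cong verticesAt≡ order) ⟨
    weightedSum (distancePolynomial G 0ⁿ) (_C k)
      ≡⟨ evaluate-x+1 (distancePolynomial G 0ⁿ) k ⟨
    coeffₓ (evaluate ℕ[x] (distancePolynomial G 0ⁿ) (ℕ[x].x ℕ[x].+ ℕ[x].1#)) k ∎
    where open ≡-Reasoning

corollary3p6 :
  (n : ℕ) (X : Pred (Word n) 0ℓ) (X? : Decidable X) (X≢∅ : Satisfiable X) →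
  let G = daisyCube X?
      0ⁿ = daisyZero X? X≢∅
      W = distancePolynomial G 0ⁿ
  in (distanceCubePolynomial G 0ⁿ ℕ[x,y].≈ evaluate ℕ[x,y] W (ℕ[x,y].x ℕ[x,y].+ ℕ[x,y].y))
     × (cubePolynomial G ℕ[x].≈ evaluate ℕ[x] W (ℕ[x].x ℕ[x].+ ℕ[x].1#))
corollary3p6 n X X? X≢∅ = D≈W[x+y] , C≈W[x+1]
  where open Daisy X? X≢∅
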